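{- There exists a constant $c$ such that for every integer $n\ge 3$, $$\lfloor \log_2 (2(n+1))\rfloor \le \mathrm{poly}_{\mathrm{F}_2}(K_n)\le \mathrm{poly}_{\mathrm{HC}}(K_n)\le \lfloor \log_2 n\rfloor + c.$$ Moreover, $\lfloor \log_2 \tfrac{8(n-1)}{3}\rfloor \le \mathrm{poly}_{\mathrm{HC}}(K_n)$ for every $n\ge 3$.
   Context: $\mathrm{F}_2(n)$ denotes the family of all $2$-factors (spanning $2$-regular subgraphs) of $K_n$, and $\mathrm{HC}(n)$ the family of all Hamiltonian cycles of $K_n$. For a graph $G$ and a family $\mathcal{H}$ of subgraphs of $G$, an edge-coloring of $G$ is $\mathcal{H}$-polychromatic if every graph in $\mathcal{H}$ contains, on its edges, every color that is used on the edges of $G$. The $\mathcal{H}$-polychromatic number $\mathrm{poly}_{\mathcal{H}}(G)$ is the largest number of colors used in an $\mathcal{H}$-polychromatic edge-coloring of $G$. -}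

module Defs where

open import Data.Nat using (ℕ; zero; suc; _≤_; _<_)
open import Data.Fin using (Fin; toℕ)
import Data.Fin as F
open import Data.Fin.Subset using (Subset; _∈_; _∉_; ∣_∣)
open import Data.Product using (Σ; ∃; _×_; _,_; proj₁; proj₂)
open import Data.Sum using (_⊎_)
open import Relation.Binary.PropositionalEquality using (_≡_)
open import Function.Definitions using (Injective)

-- A (simple) graph on the vertex set Fin n, given by neighbourhoods.
Graph : ℕ → Set
Graph n = Fin n → Subset n

IsSimple : ∀ {n} → Graph n → Set
IsSimple {n} A = (∀ (u v : Fin n) → v ∈ A u → u ∈ A v) × (∀ (v : Fin n) → v ∉ A v)

Edge : ℕ → Set
Edge n = Σ (Fin n × Fin n) (λ p → proj₁ p F.< proj₂ p)

_∈E_ : ∀ {n} → Edge n → Graph n → Set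
((u , v) , _) ∈E A = v ∈ A u

IsTwoFactor : ∀ {n} → Graph n → Set
IsTwoFactor {n} A = IsSimple A × (∀ (v : Fin n) → ∣ A v ∣ ≡ 2)

CyclicNext : (n : ℕ) → Fin n → Fin n → Set
CyclicNext n i j = (suc (toℕ i) ≡ toℕ j) ⊎ (suc (toℕ i) ≡ n × toℕ j ≡ 0)

IsHamCycle : ∀ {n} → Graph n → Set
IsHamCycle {n} A = IsSimple A ×
  Σ (Fin n → Fin n) (λ σ → Injective _≡_ _≡_ σ ×
    (∀ (u v : Fin n) → (v ∈ A u) →
       ∃ λ i → ∃ λ j → CyclicNext n i j × ((σ i ≡ u × σ j ≡ v) ⊎ (σ i ≡ v × σ j ≡ u))) ×
    (∀ (i j : Fin n) → CyclicNext n i j → σ j ∈ A (σ i)))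

Family : ℕ → Set₁
Family n = Graph n → Set

F₂ : (n : ℕ) → Family n
F₂ n = IsTwoFactor

HC : (n : ℕ) → Family n
HC n = IsHamCycle

UsesAllColours : ∀ {n k} → (Edge n → Fin k) → Set
UsesAllColours {n} {k} f = ∀ (c : Fin k) → ∃ λ (e : Edge n) → f e ≡ c

IsPolychromatic : ∀ {n k} → Family n → (Edge n → Fin k) → Set
IsPolychromatic {n} {k} H f =
  ∀ (A : Graph n) → H A → ∀ (c : Fin k) → ∃ λ (e : Edge n) → e ∈E A × f e ≡ c

IsPolyNumber : (n : ℕ) → Family n → ℕ → Set
IsPolyNumber n H p =
  (Σ (Edge n → Fin p) (λ f → UsesAllColours f × IsPolychromatic H f)) ×
  (∀ (k : ℕ) (f : Edge n → Fin k) → UsesAllColours f → IsPolychromatic H f → k ≤ p)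

{-# OPTIONS --safe #-}
-- Upper bound. If every Hamiltonian cycle meets colour t, the complement of colour class t is not
-- Hamiltonian, so by Chvátal's theorem there are a number i < n/2 and a set of m ≥ i vertices, each
-- incident to at most i edges not of colour t. Except for a bounded number of colours with
-- i = (n − 1)/2, these sets are disjoint. An edge between the sets of s and t misses colour s or t, so
-- Σ_{s<t} m_s m_t ≤ Σ m_t², that is (Σ m)² ≤ 3 Σ m², for any collection of colours. Adding the colours in
-- increasing order of m, this forces Σ m to grow like 2^(number of colours), whereas Σ m ≤ n.
--
-- Lower bounds. Colour edges by their smaller end, giving vertices consecutive blocks of colours. A
-- 2-factor that avoids the colour of a block M sends all 2|M| edge ends of M to the set P of vertices
-- before M, so |M| ≤ |P|, and |M| = |P| makes P ∪ M a union of components. Hence blocks may have size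
-- |P| + 1 for 2-factors and |P| for Hamiltonian cycles; the first three vertices carry three colours.
module Submission where

open import Defs
open import Data.Nat using (ℕ; _≤_; _+_; _*_; _∸_; _/_)
open import Data.Nat.Logarithm using (⌊log₂_⌋)
open import Data.Product using (Σ; ∃; _×_)

open import Data.Bool using (Bool; true; false; not; _∧_; _∨_; if_then_else_)
import Data.Bool as B
open import Data.Bool.Properties using (∧-comm; ∨-comm; T-≡)
open import Data.Fin using (Fin; zero; suc; toℕ; fromℕ; fromℕ<; inject₁; punchOut; finToFun; funToFin)
import Data.Fin as F
open import Data.Fin.Induction using (<-weakInduction)
import Data.Fin.Properties as FP
open import Data.Fin.Subset using (Subset; _∈_; ∣_∣)
open import Data.Fin.Subset.Properties using (_∈?_)
open import Data.List using (List; []; _∷_; _++_; _∷ʳ_; map; length; allFin; lookup; filter; reverse; cartesianProduct)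
open import Data.List.Membership.Propositional renaming (_∈_ to _∈ₗ_) using ()
open import Data.List.Membership.Propositional.Properties
  using (∈-allFin; ∈-∃++; ∈-filter⁺; ∈-cartesianProduct⁺; ∈-lookup)
open import Data.List.Properties using (map-tabulate; length-tabulate; unfold-reverse; reverse-++)
open import Data.List.Relation.Binary.Permutation.Propositional
  using (_↭_; ↭-refl; ↭-sym; ↭-trans; ↭⇒↭ₛ; prep; swap)
open import Data.List.Relation.Binary.Permutation.Propositional.Properties
  using (map⁺; ∈-resp-↭; All-resp-↭; ↭-length; ++-comm; ++⁺ˡ; shift; ↭-reverse)
open import Data.List.Relation.Binary.Permutation.Setoid.Properties using (Unique-resp-↭)
open import Data.List.Relation.Unary.All as All using (All; []; _∷_)
open import Data.List.Relation.Unary.All.Properties using (all-filter)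
open import Data.List.Relation.Unary.AllPairs using ([]; _∷_)
open import Data.List.Relation.Unary.Any using (here; there)
open import Data.List.Relation.Unary.Unique.Propositional using (Unique)
open import Data.List.Relation.Unary.Unique.Propositional.Properties using (allFin⁺; filter⁺)
open import Data.Nat hiding (ℕ; _≤_; _+_; _*_; _∸_; _/_)
open import Data.Nat.DivMod using (m/n*n≤m)
open import Data.Nat.Induction using (<-wellFounded)
open import Data.Nat.ListAction using (sum)
open import Data.Nat.ListAction.Properties using (sum-↭)
open import Data.Nat.Logarithm
  using (⌊log₂⌋-mono-≤; ⌊log₂[2*b]⌋≡1+⌊log₂b⌋; ⌊log₂[2^n]⌋≡n; ⌊log₂⌊n/2⌋⌋≡⌊log₂n⌋∸1)
open import Data.Nat.Properties
open import Data.List.Extrema ≤-totalOrder using (argmax; argmax-all; f[xs]≤f[argmax])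
open import Data.Nat.Tactic.RingSolver using (solve-∀)
open import Data.Product using (_,_; proj₁; proj₂)
open import Data.Product.Properties using (≡-dec)
open import Data.Sum as Sum using (_⊎_; inj₁; inj₂)
import Data.Vec as Vec
import Data.Vec.Properties as VP
open import Function using (_∘_; id; mk⇔; Equivalence)
open import Function.Definitions using (Injective)
open import Induction.WellFounded using (Acc; acc)
open import Relation.Binary.Definitions using (tri<; tri≈; tri>)
open import Relation.Binary.PropositionalEquality
open import Relation.Nullary using (Dec; yes; no; does; ¬_; contradiction; ¬?)
open import Relation.Nullary.Decidable using (map′; does-⇔; dec-true; dec-false; _×-dec_; _⊎-dec_; _→-dec_)
open import Relation.Unary using (Decidable)

-- Finite sums

-- The base 2 comes from the constant 3. Every collection of distinct powers of 2 satisfies (Σ m)² ≤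
-- 3 Σ m², so this inequality cannot yield faster growth. Nor does it make the sum double whenever a
-- term is added: the sizes 1, 1, 1 are admissible, with sums 1, 2, 3. The induction therefore runs
-- on a potential in both the sum and the sum of squares.
--
-- A polychromatic number is a maximum that has to be exhibited. Polychromaticity is decided by
-- enumerating vertex orderings or graphs, colourings are enumerated as tables, and the upper bound
-- limits the search for the largest number of colours.

⟦_⟧ : Bool → ℕ
⟦ true ⟧ = 1
⟦ false ⟧ = 0

⟦⟧≤1 : ∀ b → ⟦ b ⟧ ≤ 1
⟦⟧≤1 true = ≤-refl
⟦⟧≤1 false = z≤n

⟦⟧-mono : ∀ {b c} → (b ≡ true → c ≡ true) → ⟦ b ⟧ ≤ ⟦ c ⟧
⟦⟧-mono {false} h = z≤n
⟦⟧-mono {true} h rewrite h refl = ≤-refl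

does-sound : ∀ {P : Set} (P? : Dec P) → does P? ≡ true → P
does-sound (yes p) _ = p

module _ {A : Set} where

  Σ⟨_⟩ : List A → (A → ℕ) → ℕ
  Σ⟨ xs ⟩ f = sum (map f xs)

  Σ-mono-∈ : ∀ {f g : A → ℕ} xs → (∀ {x} → x ∈ₗ xs → f x ≤ g x) → Σ⟨ xs ⟩ f ≤ Σ⟨ xs ⟩ g
  Σ-mono-∈ [] h = z≤n
  Σ-mono-∈ (x ∷ xs) h = +-mono-≤ (h (here refl)) (Σ-mono-∈ xs (h ∘ there))

  Σ-mono : ∀ {f g : A → ℕ} xs → (∀ x → f x ≤ g x) → Σ⟨ xs ⟩ f ≤ Σ⟨ xs ⟩ g
  Σ-mono xs h = Σ-mono-∈ xs (λ {x} _ → h x)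

  Σ-cong : ∀ {f g : A → ℕ} xs → (∀ x → f x ≡ g x) → Σ⟨ xs ⟩ f ≡ Σ⟨ xs ⟩ g
  Σ-cong [] h = refl
  Σ-cong (x ∷ xs) h = cong₂ _+_ (h x) (Σ-cong xs h)

  Σ-mono-< : ∀ {f g : A → ℕ} {xs x} → (∀ x → f x ≤ g x) → x ∈ₗ xs → f x < g x →
             Σ⟨ xs ⟩ f < Σ⟨ xs ⟩ g
  Σ-mono-< {xs = _ ∷ xs} h (here refl) lt = +-mono-<-≤ lt (Σ-mono xs h)
  Σ-mono-< h (there x∈) lt = +-mono-≤-< (h _) (Σ-mono-< h x∈ lt)

  Σ-+ : ∀ (f g : A → ℕ) xs → Σ⟨ xs ⟩ (λ x → f x + g x) ≡ Σ⟨ xs ⟩ f + Σ⟨ xs ⟩ g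
  Σ-+ f g [] = refl
  Σ-+ f g (x ∷ xs) rewrite Σ-+ f g xs = interchange (f x) (g x) _ _
    where
    interchange : ∀ a b c d → a + b + (c + d) ≡ a + c + (b + d)
    interchange = solve-∀

  Σ-*ˡ : ∀ c (f : A → ℕ) xs → Σ⟨ xs ⟩ (λ x → c * f x) ≡ c * Σ⟨ xs ⟩ f
  Σ-*ˡ c f [] = sym (*-zeroʳ c)
  Σ-*ˡ c f (x ∷ xs) rewrite Σ-*ˡ c f xs = sym (*-distribˡ-+ c (f x) _)

  Σ-*ʳ : ∀ c (f : A → ℕ) xs → Σ⟨ xs ⟩ (λ x → f x * c) ≡ Σ⟨ xs ⟩ f * c
  Σ-*ʳ c f xs = trans (Σ-cong xs λ x → *-comm (f x) c) (trans (Σ-*ˡ c f xs) (*-comm c _))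

  Σ-const : ∀ c (xs : List A) → Σ⟨ xs ⟩ (λ _ → c) ≡ length xs * c
  Σ-const c [] = refl
  Σ-const c (x ∷ xs) = cong (c +_) (Σ-const c xs)

  Σ-∈ : ∀ {f : A → ℕ} {xs x} → x ∈ₗ xs → f x ≤ Σ⟨ xs ⟩ f
  Σ-∈ (here refl) = m≤m+n _ _
  Σ-∈ {xs = y ∷ _} (there x∈) = ≤-trans (Σ-∈ x∈) (m≤n+m _ _)

  Σ-↭ : ∀ (f : A → ℕ) {xs ys} → xs ↭ ys → Σ⟨ xs ⟩ f ≡ Σ⟨ ys ⟩ f
  Σ-↭ f p = sum-↭ (map⁺ f p)

  -- Mainly the form in which disjointness enters the counts: `xs` runs over colours, and `p` tells
  -- whose classes contain a fixed vertex or pair.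
  Σ-atMostOne : ∀ (p : A → Bool) {xs} → Unique xs →
    (∀ {x y} → x ∈ₗ xs → y ∈ₗ xs → p x ≡ true → p y ≡ true → x ≡ y) →
    Σ⟨ xs ⟩ (⟦_⟧ ∘ p) ≤ 1
  Σ-atMostOne p [] h = z≤n
  Σ-atMostOne p {x ∷ xs} (x# ∷ u) h with p x in px
  ... | false = Σ-atMostOne p u (λ a b → h (there a) (there b))
  ... | true  = s≤s (≤-trans (Σ-mono-∈ xs none) (≤-reflexive (trans (Σ-const 0 xs) (*-zeroʳ (length xs)))))
    where
    none : ∀ {y} → y ∈ₗ xs → ⟦ p y ⟧ ≤ 0
    none {y} y∈ with p y in py
    ... | false = z≤n
    ... | true  = contradiction (h (here refl) (there y∈) px py) (All.lookup x# y∈)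

Σ-swap : ∀ {A B : Set} (f : A → B → ℕ) xs ys →
         Σ⟨ xs ⟩ (λ x → Σ⟨ ys ⟩ (f x)) ≡ Σ⟨ ys ⟩ (λ y → Σ⟨ xs ⟩ (λ x → f x y))
Σ-swap f [] ys = sym (trans (Σ-const 0 ys) (*-zeroʳ (length ys)))
Σ-swap f (x ∷ xs) ys rewrite Σ-swap f xs ys = sym (Σ-+ (f x) _ ys)

∑ : ∀ {n} → (Fin n → ℕ) → ℕ
∑ {n} = Σ⟨ allFin n ⟩

∑-suc : ∀ {n} (f : Fin (suc n) → ℕ) → ∑ f ≡ f zero + ∑ (f ∘ suc)
∑-suc {n} f = cong (f zero +_) (cong sum (trans (map-tabulate suc f) (sym (map-tabulate id (f ∘ suc)))))

∑-const : ∀ n c → ∑ {n} (λ _ → c) ≡ n * c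
∑-const n c = trans (Σ-const c (allFin n)) (cong (_* c) (length-tabulate {n = n} id))

∑-≟ : ∀ {n} (a : Fin n) → ∑ (λ v → ⟦ does (v F.≟ a) ⟧) ≡ 1
∑-≟ {n} a = ≤-antisym
  (Σ-atMostOne (λ v → does (v F.≟ a)) (allFin⁺ n) λ {x} {y} _ _ p q → trans (does-sound (x F.≟ a) p) (sym (does-sound (y F.≟ a) q)))
  (≤-trans (≤-reflexive (cong ⟦_⟧ (sym (dec-true (a F.≟ a) refl)))) (Σ-∈ {f = λ v → ⟦ does (v F.≟ a) ⟧} (∈-allFin a)))

∑-<ᵇ : ∀ {n b} → b ≤ n → ∑ {n} (λ v → ⟦ toℕ v <ᵇ b ⟧) ≡ b
∑-<ᵇ {n} {zero} _ = trans (∑-const n 0) (*-zeroʳ n)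
∑-<ᵇ {suc n} {suc b} (s≤s b≤n) = trans (∑-suc {n} (λ v → ⟦ toℕ v <ᵇ suc b ⟧)) (cong suc (∑-<ᵇ b≤n))

∣∣≡∑ : ∀ {n} (p : Subset n) → ∣ p ∣ ≡ ∑ (λ v → ⟦ Vec.lookup p v ⟧)
∣∣≡∑ Vec.[] = refl
∣∣≡∑ (true Vec.∷ p) = trans (cong suc (∣∣≡∑ p)) (sym (∑-suc (λ v → ⟦ Vec.lookup (true Vec.∷ p) v ⟧)))
∣∣≡∑ (false Vec.∷ p) = trans (∣∣≡∑ p) (sym (∑-suc (λ v → ⟦ Vec.lookup (false Vec.∷ p) v ⟧)))

-- Non-Hamiltonian graphs

-- The end points stay outside the list, so `Chain R x l x` is a closed walk, and it is a
-- Hamiltonian cycle when `x ∷ l` lists every vertex once.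
Chain : {A : Set} → (A → A → Set) → A → List A → A → Set
Chain R x [] y = R x y
Chain R x (z ∷ l) y = R x z × Chain R z l y

module _ {A : Set} {R : A → A → Set} where

  chain-++⁺ : ∀ {x y z} l {m} → Chain R x l z → Chain R z m y → Chain R x (l ++ z ∷ m) y
  chain-++⁺ [] r c = r , c
  chain-++⁺ (w ∷ l) (r , c) d = r , chain-++⁺ l c d

  chain-++⁻ : ∀ {x y z} l {m} → Chain R x (l ++ z ∷ m) y → Chain R x l z × Chain R z m y
  chain-++⁻ [] c = c
  chain-++⁻ (w ∷ l) (r , c) = let c₁ , c₂ = chain-++⁻ l c in (r , c₁) , c₂

  chain-reverse : (∀ {a b} → R a b → R b a) → ∀ {x y} l → Chain R x l y → Chain R y (reverse l) x
  chain-reverse s [] r = s r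
  chain-reverse s {x} {y} (z ∷ l) (r , c) =
    subst (λ l′ → Chain R y l′ x) (sym (unfold-reverse z l))
      (chain-++⁺ (reverse l) (chain-reverse s l c) (s r))

  rotate : ∀ {x l u} → Chain R x l x → u ∈ₗ x ∷ l → ∃ λ l′ → Chain R u l′ u × u ∷ l′ ↭ x ∷ l
  rotate {l = l} c (here refl) = l , c , ↭-refl
  rotate {x} {u = u} c (there u∈l) with l₁ , l₂ , refl ← ∈-∃++ u∈l =
    let c₁ , c₂ = chain-++⁻ l₁ c in l₂ ++ x ∷ l₁ , chain-++⁺ l₂ c₂ c₁ , ++-comm (u ∷ l₂) (x ∷ l₁)

-- The rotation argument of Pósa and Ore: p and q mark the neighbours of the two ends of a path.
crossing : ∀ {A : Set} (p q : A → Bool) x l →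
  (∃ λ l₁ → ∃ λ a → ∃ λ b → ∃ λ l₂ → x ∷ l ≡ l₁ ++ a ∷ b ∷ l₂ × q a ≡ true × p b ≡ true) ⊎
  (Σ⟨ x ∷ l ⟩ (⟦_⟧ ∘ p) + Σ⟨ x ∷ l ⟩ (⟦_⟧ ∘ q) ≤ suc (length l) + ⟦ p x ⟧)
-- Without a crossing, consecutive entries a, b contribute q a + p b ≤ 1. This leaves `p` at the
-- first entry, kept exact for the induction, and `q` at the last, bounded by 1.
crossing p q x [] = inj₂ (begin
  ⟦ p x ⟧ + 0 + (⟦ q x ⟧ + 0) ≡⟨ cong₂ _+_ (+-identityʳ ⟦ p x ⟧) (+-identityʳ ⟦ q x ⟧) ⟩
  ⟦ p x ⟧ + ⟦ q x ⟧           ≤⟨ +-monoʳ-≤ ⟦ p x ⟧ (⟦⟧≤1 (q x)) ⟩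
  ⟦ p x ⟧ + 1                 ≡⟨ +-comm ⟦ p x ⟧ 1 ⟩
  1 + ⟦ p x ⟧                 ∎)
  where open ≤-Reasoning
crossing p q x (y ∷ l) with q x in qx | p y in py | crossing p q y l
... | true | true | _ = inj₁ ([] , x , y , l , refl , qx , py)
... | _ | _ | inj₁ (l₁ , a , b , l₂ , eq , qa , pb) =
  inj₁ (x ∷ l₁ , a , b , l₂ , cong (x ∷_) eq , qa , pb)
... | false | b | inj₂ h = inj₂ (begin
  ⟦ p x ⟧ + (⟦ b ⟧ + P) + (0 + (⟦ q y ⟧ + Q))      ≡⟨ reorder ⟦ p x ⟧ ⟦ b ⟧ P (⟦ q y ⟧ + Q) ⟩
  ⟦ b ⟧ + P + (⟦ q y ⟧ + Q) + ⟦ p x ⟧              ≤⟨ +-monoˡ-≤ ⟦ p x ⟧ h ⟩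
  suc (length l) + ⟦ b ⟧ + ⟦ p x ⟧                 ≤⟨ +-monoˡ-≤ ⟦ p x ⟧ (+-monoʳ-≤ (suc (length l)) (⟦⟧≤1 b)) ⟩
  suc (length l) + 1 + ⟦ p x ⟧                     ≡⟨ cong (_+ ⟦ p x ⟧) (+-comm (suc (length l)) 1) ⟩
  suc (suc (length l)) + ⟦ p x ⟧                   ∎)
  where
  open ≤-Reasoning
  P = Σ⟨ l ⟩ (⟦_⟧ ∘ p)
  Q = Σ⟨ l ⟩ (⟦_⟧ ∘ q)
  reorder : ∀ a b c d → a + (b + c) + (0 + d) ≡ b + c + d + a
  reorder = solve-∀
... | true | false | inj₂ h = inj₂ (begin
  ⟦ p x ⟧ + (0 + P) + (1 + (⟦ q y ⟧ + Q))          ≡⟨ reorder ⟦ p x ⟧ P (⟦ q y ⟧ + Q) ⟩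
  suc (P + (⟦ q y ⟧ + Q) + ⟦ p x ⟧)                ≤⟨ s≤s (+-monoˡ-≤ ⟦ p x ⟧ h) ⟩
  suc (suc (length l) + 0 + ⟦ p x ⟧)               ≡⟨ cong (λ z → suc (z + ⟦ p x ⟧)) (+-identityʳ (suc (length l))) ⟩
  suc (suc (length l)) + ⟦ p x ⟧                   ∎)
  where
  open ≤-Reasoning
  P = Σ⟨ l ⟩ (⟦_⟧ ∘ p)
  Q = Σ⟨ l ⟩ (⟦_⟧ ∘ q)
  reorder : ∀ a c d → a + (0 + c) + (1 + d) ≡ suc (c + d + a)
  reorder = solve-∀

module _ {n : ℕ} where

  Adj : (Fin n → Fin n → Bool) → Fin n → Fin n → Set
  Adj G a b = G a b ≡ true

  deg : (Fin n → Fin n → Bool) → Fin n → ℕ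
  deg G a = ∑ (λ b → ⟦ G a b ⟧)

  Symm : (Fin n → Fin n → Bool) → Set
  Symm G = ∀ a b → G a b ≡ G b a

  Hamiltonian : (Fin n → Fin n → Bool) → Set
  Hamiltonian G = ∃ λ x → ∃ λ l → x ∷ l ↭ allFin n × Chain (Adj G) x l x

  ↭allFin⇒unique : ∀ {xs} → xs ↭ allFin n → Unique xs
  ↭allFin⇒unique p = Unique-resp-↭ (setoid (Fin n)) (↭⇒↭ₛ (↭-sym p)) (allFin⁺ n)

  ↭allFin⇒length : ∀ {xs} → xs ↭ allFin n → length xs ≡ n
  ↭allFin⇒length p = trans (↭-length p) (length-tabulate {n = n} id)

  adj-sym : ∀ {G} → Symm G → ∀ {a b} → Adj G a b → Adj G b a
  adj-sym s {a} {b} e = trans (s b a) e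

  -- All neighbours of `u` and `v` lie on the interior of the path, which has n - 2 vertices.
  -- Without a crossing the two degrees would add up to at most n - 1.
  path⇒hamiltonian : ∀ {G} → Symm G → (∀ a → G a a ≡ false) → ∀ {u v l} → G u v ≡ false →
    v ∷ u ∷ l ↭ allFin n → Chain (Adj G) u l v → l ≢ [] → n ≤ deg G u + deg G v → Hamiltonian G
  path⇒hamiltonian s irr {l = []} nuv perm c l≢[] ge = contradiction refl l≢[]
  path⇒hamiltonian {G} s irr {u} {v} {x ∷ l} nuv perm c _ ge with crossing (G u) (G v) x l
  ... | inj₁ (l₁ , a , b , l₂ , eq , va , ub) =
    -- The path edge from `a` to `b` is given up: go from `u` to `a`, jump to `v`, run back to `b`
    -- and return to `u`.
    u , l₁ ++ a ∷ v ∷ reverse (b ∷ l₂) , ↭-trans reroute perm , newCycle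
    where
    pieces : Chain (Adj G) u l₁ a × Adj G a b × Chain (Adj G) b l₂ v
    pieces = chain-++⁻ l₁ (subst (λ l → Chain (Adj G) u l v) eq c)
    newCycle : Chain (Adj G) u (l₁ ++ a ∷ v ∷ reverse (b ∷ l₂)) u
    newCycle = chain-++⁺ l₁ (proj₁ pieces) (adj-sym s va ,
      subst (λ l → Chain (Adj G) v l u) (sym (unfold-reverse b l₂))
        (chain-++⁺ (reverse l₂) (chain-reverse (adj-sym s) l₂ (proj₂ (proj₂ pieces))) (adj-sym s ub)))
    reroute : u ∷ l₁ ++ a ∷ v ∷ reverse (b ∷ l₂) ↭ v ∷ u ∷ x ∷ l
    reroute = ↭-trans
      (prep u (↭-trans (++⁺ˡ l₁ (↭-trans (swap a v ↭-refl) (prep v (prep a (↭-reverse (b ∷ l₂))))))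
                       (shift v l₁ (a ∷ b ∷ l₂))))
      (↭-trans (swap u v ↭-refl) (subst (λ k → v ∷ u ∷ l₁ ++ a ∷ b ∷ l₂ ↭ v ∷ u ∷ k) (sym eq) ↭-refl))
  ... | inj₂ h = contradiction ge (<⇒≱ (begin-strict
    deg G u + deg G v
      ≡⟨ cong₂ _+_ (degree u (trans (s u v) (trans (s v u) nuv)) (irr u)) (degree v (irr v) (trans (s v u) nuv)) ⟩
    Σ⟨ x ∷ l ⟩ (⟦_⟧ ∘ G u) + Σ⟨ x ∷ l ⟩ (⟦_⟧ ∘ G v)
      ≤⟨ h ⟩
    suc (length l) + ⟦ G u x ⟧
      ≤⟨ +-monoʳ-≤ (suc (length l)) (⟦⟧≤1 (G u x)) ⟩
    suc (length l) + 1
      ≡⟨ +-comm (suc (length l)) 1 ⟩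
    suc (suc (length l))
      <⟨ n<1+n _ ⟩
    suc (suc (suc (length l)))
      ≡⟨ ↭allFin⇒length perm ⟩
    n ∎))
    where
    open ≤-Reasoning
    degree : ∀ w → G w v ≡ false → G w u ≡ false → deg G w ≡ Σ⟨ x ∷ l ⟩ (⟦_⟧ ∘ G w)
    degree w wv wu = trans (Σ-↭ (⟦_⟧ ∘ G w) (↭-sym perm))
      (cong₂ (λ b c → ⟦ b ⟧ + (⟦ c ⟧ + Σ⟨ x ∷ l ⟩ (⟦_⟧ ∘ G w))) wv wu)

  addEdge : Fin n → Fin n → (Fin n → Fin n → Bool) → Fin n → Fin n → Bool
  addEdge u v G a b = G a b ∨ (does (a F.≟ u) ∧ does (b F.≟ v) ∨ does (a F.≟ v) ∧ does (b F.≟ u))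

  addEdge-sym : ∀ u v {G} → Symm G → Symm (addEdge u v G)
  addEdge-sym u v s a b = cong₂ _∨_ (s a b) (trans (∨-comm (does (a F.≟ u) ∧ does (b F.≟ v)) _)
    (cong₂ _∨_ (∧-comm (does (a F.≟ v)) _) (∧-comm (does (a F.≟ u)) _)))

  addEdge⁻ : ∀ u v G {a b} → Adj (addEdge u v G) a b → Adj G a b ⊎ (a ≡ u × b ≡ v ⊎ a ≡ v × b ≡ u)
  addEdge⁻ u v G {a} {b} e with G a b
  ... | true = inj₁ refl
  ... | false with a F.≟ u | b F.≟ v | a F.≟ v | b F.≟ u
  ...   | yes p | yes q | _ | _ = inj₂ (inj₁ (p , q))
  ...   | yes p | no q | yes r | yes t = inj₂ (inj₂ (r , t))
  ...   | no p | _ | yes r | yes t = inj₂ (inj₂ (r , t))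

  module _ {G : Fin n → Fin n → Bool} (s : Symm G) (irr : ∀ a → G a a ≡ false) where

    -- The Bondy-Chvátal closure. Removing the new edge from a Hamiltonian cycle leaves a
    -- Hamiltonian path of `G` from `v` to `u`, which `path⇒hamiltonian` closes. With the cycle
    -- rotated to start at `u`, the new edge is its first edge, its last edge or absent.
    closure-step : ∀ {u v} → 3 ≤ n → u ≢ v → G u v ≡ false → n ≤ deg G u + deg G v →
                   Hamiltonian (addEdge u v G) → Hamiltonian G
    closure-step {u} {v} 3≤n u≢v nuv ge (x , l , perm , c)
      with rotate c (∈-resp-↭ (↭-sym perm) (∈-allFin u))
    ... | [] , c′ , perm′ =
      contradiction (subst (3 ≤_) (sym (↭allFin⇒length (↭-trans perm′ perm))) 3≤n) λ { (s≤s ()) }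
    ... | b ∷ l′ , (ub , c′) , perm′ = viaFirst b l′ (b F.≟ v) ub c′ (↭-trans perm′ perm)
      where
      G′ = addEdge u v G

      old : ∀ {a b} → a ≢ u → b ≢ u → Adj G′ a b → Adj G a b
      old a≢u b≢u e with addEdge⁻ u v G e
      ... | inj₁ g = g
      ... | inj₂ (inj₁ (a≡u , _)) = contradiction a≡u a≢u
      ... | inj₂ (inj₂ (_ , b≡u)) = contradiction b≡u b≢u

      oldˡ : ∀ {a b} → a ≢ u → a ≢ v → Adj G′ a b → Adj G a b
      oldˡ a≢u a≢v e with addEdge⁻ u v G e
      ... | inj₁ g = g
      ... | inj₂ (inj₁ (a≡u , _)) = contradiction a≡u a≢u
      ... | inj₂ (inj₂ (a≡v , _)) = contradiction a≡v a≢v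

      oldʳ : ∀ {a b} → a ≢ v → b ≢ v → Adj G′ a b → Adj G a b
      oldʳ a≢v b≢v e with addEdge⁻ u v G e
      ... | inj₁ g = g
      ... | inj₂ (inj₁ (_ , b≡v)) = contradiction b≡v b≢v
      ... | inj₂ (inj₂ (a≡v , _)) = contradiction a≡v a≢v

      oldChain : ∀ {a} l → a ≢ u → a ≢ v → All (u ≢_) l → All (v ≢_) l → Chain (Adj G′) a l u → Chain (Adj G) a l u
      oldChain [] a≢u a≢v _ _ e = oldˡ a≢u a≢v e
      oldChain (z ∷ l) a≢u a≢v (u≢z ∷ us) (v≢z ∷ vs) (e , c) =
        oldˡ a≢u a≢v e , oldChain l (u≢z ∘ sym) (v≢z ∘ sym) us vs c

      oldOrLast : ∀ a l → a ≢ u → All (u ≢_) l → Chain (Adj G′) a l u →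
                  Chain (Adj G) a l u ⊎ ∃ λ m → a ∷ l ≡ m ∷ʳ v
      oldOrLast a [] a≢u _ e with addEdge⁻ u v G e
      ... | inj₁ g = inj₁ g
      ... | inj₂ (inj₁ (a≡u , _)) = contradiction a≡u a≢u
      ... | inj₂ (inj₂ (refl , _)) = inj₂ ([] , refl)
      oldOrLast a (z ∷ l) a≢u (u≢z ∷ us) (e , c) with oldOrLast z l (u≢z ∘ sym) us c
      ... | inj₁ c′ = inj₁ (old a≢u (u≢z ∘ sym) e , c′)
      ... | inj₂ (m , eq) = inj₂ (a ∷ m , cong (a ∷_) eq)

      alongPath : ∀ l → u ∷ v ∷ l ↭ allFin n → Chain (Adj G′) v l u → Hamiltonian G
      alongPath [] perm _ =
        contradiction (subst (3 ≤_) (sym (↭allFin⇒length perm)) 3≤n) λ { (s≤s (s≤s ())) }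
      alongPath (z ∷ l) perm (e , c) with ↭allFin⇒unique perm
      ... | (_ ∷ u≢z ∷ us) ∷ (v≢z ∷ vs) ∷ _ =
        path⇒hamiltonian s irr (trans (s v u) nuv) perm
          (old (u≢v ∘ sym) (u≢z ∘ sym) e , oldChain l (u≢z ∘ sym) (v≢z ∘ sym) us vs c) (λ ())
          (subst (n ≤_) (+-comm (deg G u) (deg G v)) ge)

      viaFirst : ∀ b l → Dec (b ≡ v) → Adj G′ u b → Chain (Adj G′) b l u → u ∷ b ∷ l ↭ allFin n → Hamiltonian G
      viaFirst b l (yes refl) ub c perm = alongPath l perm c
      viaFirst b l (no b≢v) ub c perm with ↭allFin⇒unique perm
      ... | (u≢b ∷ us) ∷ _ with oldOrLast b l (u≢b ∘ sym) us c
      ...   | inj₁ c′ = u , b ∷ l , perm , oldʳ u≢v b≢v ub , c′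
      -- `v` comes last, so the cycle is read backwards to put the new edge first.
      ...   | inj₂ (m , eq) = alongPath (reverse m)
        (↭-trans (prep u (subst (_↭ b ∷ l) reversed (↭-reverse (b ∷ l)))) perm)
        (proj₂ (subst (λ k → Chain (Adj G′) u k u) reversed
          (chain-reverse (adj-sym (addEdge-sym u v s)) (b ∷ l) (ub , c))))
        where
        reversed : reverse (b ∷ l) ≡ v ∷ reverse m
        reversed = trans (cong reverse eq) (reverse-++ m (v ∷ []))

    complete⇒hamiltonian : 3 ≤ n → (∀ a b → a ≢ b → Adj G a b) → Hamiltonian G
    complete⇒hamiltonian (s≤s (s≤s _)) all with u ← ↭allFin⇒unique ↭-refl =
      zero , _ , ↭-refl , walk _ _ u (λ ())
      where
      walk : ∀ x l → Unique (x ∷ l) → l ≢ [] → Chain (Adj G) x l x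
      walk x [] _ ne = contradiction refl ne
      walk x (y ∷ l) ((x≢y ∷ xs) ∷ u) _ = all x y x≢y , onward y l (x≢y ∘ sym) u xs
        where
        onward : ∀ y l → y ≢ x → Unique (y ∷ l) → All (x ≢_) l → Chain (Adj G) y l x
        onward y [] y≢x _ _ = all y x y≢x
        onward y (z ∷ l) y≢x ((y≢z ∷ _) ∷ u) (x≢z ∷ xs) = all y z y≢z , onward z l (x≢z ∘ sym) u xs

  -- The failure of Chvátal's degree condition for Hamiltonicity at i.
  ManySmallDegrees : (Fin n → Fin n → Bool) → ℕ → (Fin n → Bool) → Set
  ManySmallDegrees G i S = 1 ≤ i × 2 * i < n × i ≤ ∑ (⟦_⟧ ∘ S) × (∀ a → S a ≡ true → deg G a ≤ i)

  module _ {G : Fin n → Fin n → Bool} (s : Symm G) (irr : ∀ a → G a a ≡ false) where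

    -- Chvátal's choice: `S` consists of the non-neighbours of `v` other than `v`. By maximality
    -- each has degree at most `deg G u`, and there are n - 1 - `deg G v` ≥ `deg G u` of them.
    maximalPair⇒manySmall : 3 ≤ n → ∀ {u v} → u ≢ v → G u v ≡ false → deg G u ≤ deg G v →
      deg G u + deg G v < n →
      (∀ a b → a ≢ b → G a b ≡ false → deg G a + deg G b ≤ deg G u + deg G v) →
      ∃ λ i → ∃ λ S → ManySmallDegrees G i S
    maximalPair⇒manySmall 3≤n {u} {v} u≢v nuv du≤dv lt max =
      -- An isolated `u` would give i = 0. Raising i to 1 is harmless, because `u` itself lies in
      -- `S` and 2 < n.
      1 ⊔ deg G u , S , m≤m⊔n 1 (deg G u) , 2i<n , ⊔-lub 1≤∣S∣ d≤∣S∣ , small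
      where
      open ≤-Reasoning
      S : Fin n → Bool
      S w = not (G v w ∨ does (w F.≟ v))

      covers : ∀ w → ⟦ S w ⟧ + (⟦ G v w ⟧ + ⟦ does (w F.≟ v) ⟧) ≡ 1
      covers w with w F.≟ v | G v w in e
      ... | yes refl | true = contradiction (trans (sym e) (irr v)) λ ()
      ... | yes refl | false = refl
      ... | no _ | true = refl
      ... | no _ | false = refl

      ∣S∣+1+dv : ∑ (⟦_⟧ ∘ S) + (deg G v + 1) ≡ n
      ∣S∣+1+dv = begin-equality
        ∑ (⟦_⟧ ∘ S) + (deg G v + 1)
          ≡⟨ cong (λ z → ∑ (⟦_⟧ ∘ S) + (deg G v + z)) (∑-≟ v) ⟨
        ∑ (⟦_⟧ ∘ S) + (deg G v + ∑ (λ w → ⟦ does (w F.≟ v) ⟧))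
          ≡⟨ cong (∑ (⟦_⟧ ∘ S) +_) (Σ-+ (⟦_⟧ ∘ G v) _ (allFin n)) ⟨
        ∑ (⟦_⟧ ∘ S) + ∑ (λ w → ⟦ G v w ⟧ + ⟦ does (w F.≟ v) ⟧)
          ≡⟨ Σ-+ (⟦_⟧ ∘ S) _ (allFin n) ⟨
        ∑ (λ w → ⟦ S w ⟧ + (⟦ G v w ⟧ + ⟦ does (w F.≟ v) ⟧))
          ≡⟨ Σ-cong (allFin n) covers ⟩
        ∑ {n} (λ _ → 1)
          ≡⟨ trans (∑-const n 1) (*-identityʳ n) ⟩
        n ∎

      d≤∣S∣ : deg G u ≤ ∑ (⟦_⟧ ∘ S)
      d≤∣S∣ = +-cancelʳ-≤ (deg G v + 1) _ _ (begin
        deg G u + (deg G v + 1) ≡⟨ +-assoc (deg G u) _ 1 ⟨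
        deg G u + deg G v + 1   ≡⟨ +-comm _ 1 ⟩
        suc (deg G u + deg G v) ≤⟨ lt ⟩
        n                       ≡⟨ ∣S∣+1+dv ⟨
        ∑ (⟦_⟧ ∘ S) + (deg G v + 1) ∎)

      u∈S : S u ≡ true
      u∈S rewrite trans (s v u) nuv | dec-false (u F.≟ v) u≢v = refl

      1≤∣S∣ : 1 ≤ ∑ (⟦_⟧ ∘ S)
      1≤∣S∣ = ≤-trans (≤-reflexive (cong ⟦_⟧ (sym u∈S))) (Σ-∈ {f = ⟦_⟧ ∘ S} (∈-allFin u))

      2i<n : 2 * (1 ⊔ deg G u) < n
      2i<n with ⊔-sel 1 (deg G u)
      ... | inj₁ e rewrite e = 3≤n
      ... | inj₂ e rewrite e = ≤-<-trans (+-monoʳ-≤ (deg G u) (≤-trans (≤-reflexive (+-identityʳ _)) du≤dv)) lt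

      small : ∀ w → S w ≡ true → deg G w ≤ 1 ⊔ deg G u
      small w w∈S with G v w in e | w F.≟ v
      ... | false | no w≢v = ≤-trans
        (+-cancelʳ-≤ (deg G v) _ _ (max w v w≢v (trans (s w v) e))) (m≤n⊔m 1 (deg G u))

  -- As long as the maximal degree sum of a non-adjacent pair is at least n, that pair is joined,
  -- and by `closure-step` the graph stays non-Hamiltonian. It never becomes complete, so the
  -- process stops at a maximal pair with sum below n.
  nonHamiltonian⇒manySmall : 3 ≤ n → ∀ G → Symm G → (∀ a → G a a ≡ false) → ¬ Hamiltonian G →
                             ∃ λ i → ∃ λ S → ManySmallDegrees G i S
  nonHamiltonian⇒manySmall 3≤n G s irr = go G s irr (<-wellFounded _)
    where
    nonEdges : (Fin n → Fin n → Bool) → ℕ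
    nonEdges G = ∑ (λ a → ∑ (λ b → ⟦ not (G a b) ⟧))

    addEdge-nonEdges : ∀ {G u v} → G u v ≡ false → nonEdges (addEdge u v G) < nonEdges G
    addEdge-nonEdges {G} {u} {v} nuv =
      Σ-mono-< (λ a → Σ-mono (allFin n) (fewer a)) (∈-allFin u)
        (Σ-mono-< (fewer u) (∈-allFin v) strict)
      where
      fewer : ∀ a b → ⟦ not (addEdge u v G a b) ⟧ ≤ ⟦ not (G a b) ⟧
      fewer a b with G a b
      ... | true = ≤-refl
      ... | false = ⟦⟧≤1 _
      strict : ⟦ not (addEdge u v G u v) ⟧ < ⟦ not (G u v) ⟧
      strict rewrite nuv | dec-true (u F.≟ u) refl | dec-true (v F.≟ v) refl = s≤s z≤n

    go : ∀ G → Symm G → (∀ a → G a a ≡ false) → Acc _<_ (nonEdges G) → ¬ Hamiltonian G →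
         ∃ λ i → ∃ λ S → ManySmallDegrees G i S
    go G s irr (acc rec) ¬ham = choose _ refl
      where
      NonAdj : Fin n × Fin n → Set
      NonAdj (a , b) = a ≢ b × G a b ≡ false
      nonAdj? : ∀ p → Dec (NonAdj p)
      nonAdj? (a , b) = ¬? (a F.≟ b) ×-dec (G a b B.≟ false)
      w : Fin n × Fin n → ℕ
      w (a , b) = deg G a + deg G b
      pairs = filter nonAdj? (cartesianProduct (allFin n) (allFin n))

      ∈pairs : ∀ {a b} → a ≢ b → G a b ≡ false → (a , b) ∈ₗ pairs
      ∈pairs {a} {b} ne nab = ∈-filter⁺ nonAdj? (∈-cartesianProduct⁺ (∈-allFin a) (∈-allFin b)) (ne , nab)

      choose : ∀ ps → ps ≡ pairs → ∃ λ i → ∃ λ S → ManySmallDegrees G i S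
      choose [] eq = contradiction (complete⇒hamiltonian s irr 3≤n adjacent) ¬ham
        where
        adjacent : ∀ a b → a ≢ b → Adj G a b
        adjacent a b ne with G a b in e
        ... | true = refl
        ... | false = contradiction (subst ((a , b) ∈ₗ_) (sym eq) (∈pairs ne e)) λ ()
      choose (p ∷ ps) eq = decide (proj₁ top) (proj₂ top) top-nonAdj top-max
        where
        all = subst (All NonAdj) (sym eq) (all-filter nonAdj? (cartesianProduct (allFin n) (allFin n)))
        top = argmax w p (p ∷ ps)
        top-nonAdj : NonAdj top
        top-nonAdj = argmax-all w (All.head all) all
        top-max : ∀ a b → a ≢ b → G a b ≡ false → w (a , b) ≤ w top
        top-max a b ne nab = All.lookup (f[xs]≤f[argmax] {f = w} p (p ∷ ps)) (subst ((a , b) ∈ₗ_) (sym eq) (∈pairs ne nab))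

        decide : ∀ u v → NonAdj (u , v) → (∀ a b → a ≢ b → G a b ≡ false → w (a , b) ≤ w (u , v)) →
                 ∃ λ i → ∃ λ S → ManySmallDegrees G i S
        decide u v (u≢v , nuv) max with w (u , v) <? n | ≤-total (deg G u) (deg G v)
        ... | yes lt | inj₁ le = maximalPair⇒manySmall s irr 3≤n u≢v nuv le lt max
        ... | yes lt | inj₂ le = maximalPair⇒manySmall s irr 3≤n (u≢v ∘ sym) (trans (s v u) nuv) le
          (subst (_< n) (+-comm (deg G u) _) lt)
          (λ a b ne nab → ≤-trans (max a b ne nab) (≤-reflexive (+-comm (deg G u) _)))
        ... | no ≮ | _ with go (addEdge u v G) (addEdge-sym u v s) irr′ (rec (addEdge-nonEdges {G} nuv))
                            (¬ham ∘ closure-step s irr 3≤n u≢v nuv (≮⇒≥ ≮))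
          where
          irr′ : ∀ a → addEdge u v G a a ≡ false
          irr′ a with addEdge u v G a a in e
          ... | false = refl
          ... | true with addEdge⁻ u v G e
          ...   | inj₁ g = contradiction (trans (sym g) (irr a)) λ ()
          ...   | inj₂ (inj₁ (a≡u , a≡v)) = contradiction (trans (sym a≡u) a≡v) u≢v
          ...   | inj₂ (inj₂ (a≡v , a≡u)) = contradiction (trans (sym a≡u) a≡v) u≢v
        -- Degrees in `G` are at most those in the larger graph, so its `i` and `S` serve `G` as
        -- well.
        ...   | i , S , 1≤i , 2i<n , i≤∣S∣ , small = i , S , 1≤i , 2i<n , i≤∣S∣ ,
          λ a a∈S → ≤-trans (Σ-mono (allFin n) (λ b → ⟦⟧-mono (λ g → cong (_∨ _) g))) (small a a∈S)

-- Counting disjoint dense colour classes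

-- For a sum s and a sum of squares q, the potential max(2s² − 3q, s²/4) at least quadruples
-- whenever a new largest term is added. Large p s q bounds 16 times this potential below by p².
Large : ℕ → ℕ → ℕ → Set
Large p s q = p * p ≤ 4 * (s * s) ⊎ p * p + 48 * q ≤ 32 * (s * s)

Large-grow : ∀ p s q x → 1 ≤ x → s * s ≤ 3 * q → q ≤ x * s → (x + s) * (x + s) ≤ 3 * (x * x + q) →
             Large p s q → Large (2 * p) (x + s) (x * x + q)
Large-grow p s q x 1≤x s²≤3q q≤xs sq (inj₁ h) with ≤-total s x
-- A new term at least as large as the sum doubles it, which the part s²/4 of the potential records.
... | inj₁ s≤x = inj₁ (begin
  2 * p * (2 * p)            ≡⟨ quadruple p ⟩
  4 * (p * p)                ≤⟨ *-monoʳ-≤ 4 h ⟩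
  4 * (4 * (s * s))          ≡⟨ cong (4 *_) (sym (double s)) ⟩
  4 * ((s + s) * (s + s))    ≤⟨ *-monoʳ-≤ 4 (*-mono-≤ (+-monoˡ-≤ s s≤x) (+-monoˡ-≤ s s≤x)) ⟩
  4 * ((x + s) * (x + s))    ∎)
  where
  open ≤-Reasoning
  quadruple : ∀ p → 2 * p * (2 * p) ≡ 4 * (p * p)
  quadruple = solve-∀
  double : ∀ s → (s + s) * (s + s) ≡ 4 * (s * s)
  double = solve-∀
... | inj₂ x≤s = inj₂ (begin
  2 * p * (2 * p) + 48 * (x * x + q)
    ≡⟨ expand p x q ⟩
  4 * (p * p) + 32 * (x * x) + 16 * (x * x) + 48 * q
    ≤⟨ +-mono-≤ (+-mono-≤ (+-monoˡ-≤ (32 * (x * x)) (*-monoʳ-≤ 4 h)) (*-monoʳ-≤ 16 (*-monoʳ-≤ x x≤s))) (*-monoʳ-≤ 48 q≤xs) ⟩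
  4 * (4 * (s * s)) + 32 * (x * x) + 16 * (x * s) + 48 * (x * s)
    ≤⟨ m≤m+n _ (16 * (s * s)) ⟩
  4 * (4 * (s * s)) + 32 * (x * x) + 16 * (x * s) + 48 * (x * s) + 16 * (s * s)
    ≡⟨ collect s x ⟩
  32 * ((x + s) * (x + s)) ∎)
  where
  open ≤-Reasoning
  expand : ∀ p x q → 2 * p * (2 * p) + 48 * (x * x + q) ≡ 4 * (p * p) + 32 * (x * x) + 16 * (x * x) + 48 * q
  expand = solve-∀
  collect : ∀ s x → 4 * (4 * (s * s)) + 32 * (x * x) + 16 * (x * s) + 48 * (x * s) + 16 * (s * s) ≡ 32 * ((x + s) * (x + s))
  collect = solve-∀
Large-grow p s q x 1≤x s²≤3q q≤xs sq (inj₂ h) with ≤-total s x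
... | inj₂ x≤s = inj₂ (+-cancelʳ-≤ (144 * q) _ _ (begin
  2 * p * (2 * p) + 48 * (x * x + q) + 144 * q
    ≡⟨ regroup p x q ⟩
  4 * (p * p + 48 * q) + 48 * (x * x)
    ≤⟨ +-monoˡ-≤ _ (*-monoʳ-≤ 4 h) ⟩
  4 * (32 * (s * s)) + 48 * (x * x)
    ≤⟨ +-cancelʳ-≤ (144 * (x * x)) _ _ (≤-trans quadratic (≤-trans (+-monoʳ-≤ (32 * ((x + s) * (x + s))) (*-monoʳ-≤ 48 sq)) (≤-reflexive (distribute ((x + s) * (x + s)) x q)))) ⟩
  32 * ((x + s) * (x + s)) + 144 * q ∎))
  where
  open ≤-Reasoning
  regroup : ∀ p x q → 2 * p * (2 * p) + 48 * (x * x + q) + 144 * q ≡ 4 * (p * p + 48 * q) + 48 * (x * x)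
  regroup = solve-∀
  distribute : ∀ y x q → 32 * y + 48 * (3 * (x * x + q)) ≡ 32 * y + 144 * q + 144 * (x * x)
  distribute = solve-∀
  instance
    x+s≢0 : NonZero (x + s)
    x+s≢0 = >-nonZero (≤-trans 1≤x (m≤m+n x s))
  -- The inequality for the enlarged list forces the new largest term to be at least half the old
  -- sum; hence 7x - 3s > 0 below.
  x+s≤3x : x + s ≤ 3 * x
  x+s≤3x = *-cancelʳ-≤ (x + s) (3 * x) (x + s) (begin
    (x + s) * (x + s)      ≤⟨ sq ⟩
    3 * (x * x + q)        ≤⟨ *-monoʳ-≤ 3 (+-monoʳ-≤ (x * x) q≤xs) ⟩
    3 * (x * x + x * s)    ≡⟨ factor x s ⟩
    3 * x * (x + s)        ∎)
    where
    factor : ∀ x s → 3 * (x * x + x * s) ≡ 3 * x * (x + s)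
    factor = solve-∀
  -- Up to the factor 16 this is (s − x)(7x − 3s) ≥ 0.
  quadratic : 4 * (32 * (s * s)) + 48 * (x * x) + 144 * (x * x) ≤ 32 * ((x + s) * (x + s)) + 48 * ((x + s) * (x + s))
  quadratic with e ← s ∸ x | refl ← sym (m+[n∸m]≡n x≤s) = begin
    4 * (32 * ((x + e) * (x + e))) + 48 * (x * x) + 144 * (x * x)
      ≡⟨ expandˡ x e ⟩
    320 * (x * x) + 256 * (x * e) + 80 * (e * e) + 48 * (e * e)
      ≤⟨ +-monoʳ-≤ (320 * (x * x) + 256 * (x * e) + 80 * (e * e)) (*-mono-≤ (m≤m+n 48 16) (*-monoˡ-≤ e e≤x)) ⟩
    320 * (x * x) + 256 * (x * e) + 80 * (e * e) + 64 * (x * e)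
      ≡⟨ expandʳ x e ⟨
    32 * ((x + (x + e)) * (x + (x + e))) + 48 * ((x + (x + e)) * (x + (x + e))) ∎
    where
    e≤x : e ≤ x
    e≤x = +-cancelˡ-≤ x _ _ (+-cancelˡ-≤ x _ _ (≤-trans x+s≤3x (≤-reflexive (triple x))))
      where
      triple : ∀ x → 3 * x ≡ x + (x + x)
      triple = solve-∀
    expandˡ : ∀ x e → 4 * (32 * ((x + e) * (x + e))) + 48 * (x * x) + 144 * (x * x) ≡ 320 * (x * x) + 256 * (x * e) + 80 * (e * e) + 48 * (e * e)
    expandˡ = solve-∀
    expandʳ : ∀ x e → 32 * ((x + (x + e)) * (x + (x + e))) + 48 * ((x + (x + e)) * (x + (x + e))) ≡ 320 * (x * x) + 256 * (x * e) + 80 * (e * e) + 64 * (x * e)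
    expandʳ = solve-∀
... | inj₁ s≤x with ≤-total (3 * s) x
-- The old potential is at most s², and a sum multiplied by 4 or more gives (x + s)²/4 ≥ 4s².
...   | inj₁ 3s≤x = inj₁ (begin
  2 * p * (2 * p)                 ≡⟨ quadruple p ⟩
  4 * (p * p)                     ≤⟨ *-monoʳ-≤ 4 p²≤16s² ⟩
  4 * (16 * (s * s))              ≡⟨ square s ⟩
  4 * ((3 * s + s) * (3 * s + s)) ≤⟨ *-monoʳ-≤ 4 (*-mono-≤ (+-monoˡ-≤ s 3s≤x) (+-monoˡ-≤ s 3s≤x)) ⟩
  4 * ((x + s) * (x + s))         ∎)
  where
  open ≤-Reasoning
  quadruple : ∀ p → 2 * p * (2 * p) ≡ 4 * (p * p)
  quadruple = solve-∀
  square : ∀ s → 4 * (16 * (s * s)) ≡ 4 * ((3 * s + s) * (3 * s + s))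
  square = solve-∀
  halve : ∀ s → 32 * s ≡ 16 * s + 16 * s
  halve = solve-∀
  triple : ∀ q → 16 * (3 * q) ≡ 48 * q
  triple = solve-∀
  p²≤16s² : p * p ≤ 16 * (s * s)
  p²≤16s² = +-cancelʳ-≤ (16 * (s * s)) _ _ (begin
    p * p + 16 * (s * s)          ≤⟨ +-monoʳ-≤ (p * p) (*-monoʳ-≤ 16 s²≤3q) ⟩
    p * p + 16 * (3 * q)          ≡⟨ cong (p * p +_) (triple q) ⟩
    p * p + 48 * q                ≤⟨ h ⟩
    32 * (s * s)                  ≡⟨ halve (s * s) ⟩
    16 * (s * s) + 16 * (s * s)   ∎)
...   | inj₂ x≤3s = inj₂ (+-cancelʳ-≤ (144 * q) _ _ (begin
  2 * p * (2 * p) + 48 * (x * x + q) + 144 * q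
    ≡⟨ regroup p x q ⟩
  4 * (p * p + 48 * q) + 48 * (x * x)
    ≤⟨ +-monoˡ-≤ _ (*-monoʳ-≤ 4 h) ⟩
  4 * (32 * (s * s)) + 48 * (x * x)
    ≤⟨ quadratic ⟩
  32 * ((x + s) * (x + s)) + 48 * (s * s)
    ≤⟨ +-monoʳ-≤ (32 * ((x + s) * (x + s))) (*-monoʳ-≤ 48 s²≤3q) ⟩
  32 * ((x + s) * (x + s)) + 48 * (3 * q)
    ≡⟨ cong (32 * ((x + s) * (x + s)) +_) (triple q) ⟩
  32 * ((x + s) * (x + s)) + 144 * q ∎))
  where
  open ≤-Reasoning
  regroup : ∀ p x q → 2 * p * (2 * p) + 48 * (x * x + q) + 144 * q ≡ 4 * (p * p + 48 * q) + 48 * (x * x)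
  regroup = solve-∀
  triple : ∀ q → 48 * (3 * q) ≡ 144 * q
  triple = solve-∀
  -- Up to the factor 16 this is (x − s)(3s − x) ≥ 0.
  quadratic : 4 * (32 * (s * s)) + 48 * (x * x) ≤ 32 * ((x + s) * (x + s)) + 48 * (s * s)
  quadratic with d ← x ∸ s | refl ← sym (m+[n∸m]≡n s≤x) = begin
    4 * (32 * (s * s)) + 48 * ((s + d) * (s + d))
      ≡⟨ expandˡ s d ⟩
    176 * (s * s) + 96 * (s * d) + 32 * (d * d) + 16 * (d * d)
      ≤⟨ +-monoʳ-≤ (176 * (s * s) + 96 * (s * d) + 32 * (d * d)) (*-monoʳ-≤ 16 (*-monoˡ-≤ d d≤2s)) ⟩
    176 * (s * s) + 96 * (s * d) + 32 * (d * d) + 16 * ((s + s) * d)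
      ≡⟨ expandʳ s d ⟨
    32 * ((s + d + s) * (s + d + s)) + 48 * (s * s) ∎
    where
    d≤2s : d ≤ s + s
    d≤2s = +-cancelˡ-≤ s _ _ (≤-trans x≤3s (≤-reflexive (thrice s)))
      where
      thrice : ∀ s → 3 * s ≡ s + (s + s)
      thrice = solve-∀
    expandˡ : ∀ s d → 4 * (32 * (s * s)) + 48 * ((s + d) * (s + d)) ≡ 176 * (s * s) + 96 * (s * d) + 32 * (d * d) + 16 * (d * d)
    expandˡ = solve-∀
    expandʳ : ∀ s d → 32 * ((s + d + s) * (s + d + s)) + 48 * (s * s) ≡ 176 * (s * s) + 96 * (s * d) + 32 * (d * d) + 16 * ((s + s) * d)
    expandʳ = solve-∀

square-cancel-≤ : ∀ {a b} → a * a ≤ b * b → a ≤ b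
square-cancel-≤ h = ≮⇒≥ λ b<a → <⇒≱ (*-mono-< b<a b<a) h

-- Since s² ≤ 3q, both parts of the potential are at most s².
Large⇒≤ : ∀ p s q → s * s ≤ 3 * q → Large p s q → p ≤ 4 * s
Large⇒≤ p s q s²≤3q L = square-cancel-≤ (≤-trans (bound L) (≤-reflexive (square s)))
  where
  square : ∀ s → 16 * (s * s) ≡ 4 * s * (4 * s)
  square = solve-∀
  bound : Large p s q → p * p ≤ 16 * (s * s)
  bound (inj₁ h) = ≤-trans h (*-monoˡ-≤ (s * s) (m≤m+n 4 12))
  bound (inj₂ h) = +-cancelʳ-≤ (16 * (s * s)) _ _ (begin
    p * p + 16 * (s * s)          ≤⟨ +-monoʳ-≤ (p * p) (*-monoʳ-≤ 16 s²≤3q) ⟩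
    p * p + 16 * (3 * q)          ≡⟨ cong (p * p +_) (triple q) ⟩
    p * p + 48 * q                ≤⟨ h ⟩
    32 * (s * s)                  ≡⟨ halve (s * s) ⟩
    16 * (s * s) + 16 * (s * s)   ∎)
    where
    open ≤-Reasoning
    halve : ∀ s → 32 * s ≡ 16 * s + 16 * s
    halve = solve-∀
    triple : ∀ q → 16 * (3 * q) ≡ 48 * q
    triple = solve-∀

module _ {C : Set} (m : C → ℕ) where

  extractMax : ∀ x xs → ∃ λ y → ∃ λ ys → x ∷ xs ↭ y ∷ ys × All (λ z → m z ≤ m y) ys
  extractMax x [] = x , [] , ↭-refl , []
  extractMax x (x′ ∷ xs) with y , ys , perm , ub ← extractMax x′ xs with ≤-total (m x) (m y)
  ... | inj₁ x≤y = y , x ∷ ys , ↭-trans (prep x perm) (swap x y ↭-refl) , x≤y ∷ ub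
  ... | inj₂ y≤x = x , x′ ∷ xs , ↭-refl ,
    All-resp-↭ (↭-sym perm) (y≤x ∷ All.map (λ z≤y → ≤-trans z≤y y≤x) ub)

  module _ (P : List C → Set)
           (P-tail : ∀ {x xs} → P (x ∷ xs) → P xs)
           (P-↭ : ∀ {xs ys} → xs ↭ ys → P xs → P ys)
           (P-pos : ∀ {x xs} → P (x ∷ xs) → 1 ≤ m x)
           (P-squares : ∀ {xs} → P xs → Σ⟨ xs ⟩ m * Σ⟨ xs ⟩ m ≤ 3 * Σ⟨ xs ⟩ (λ x → m x * m x))
           where

    -- The list is unsorted, so the induction removes a largest element each time; this is why `P`
    -- has to survive permutations and tails. A single element starts with p = 2.
    P⇒Large : ∀ j x xs → length xs ≡ j → P (x ∷ xs) →
      Large (2 ^ suc j) (Σ⟨ x ∷ xs ⟩ m) (Σ⟨ x ∷ xs ⟩ (λ x → m x * m x))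
    P⇒Large zero x [] refl Px rewrite +-identityʳ (m x) =
      inj₁ (*-monoʳ-≤ 4 (*-mono-≤ (P-pos Px) (P-pos Px)))
    P⇒Large (suc j) x xs@(_ ∷ _) len Px with extractMax x xs
    ... | y , [] , perm , ub = contradiction (trans (sym (cong suc len)) (↭-length perm)) λ ()
    ... | y , z ∷ ys , perm , ub =
      subst₂ (Large (2 ^ suc (suc j))) (Σ-↭ m (↭-sym perm)) (Σ-↭ (λ x → m x * m x) (↭-sym perm))
        (Large-grow (2 ^ suc j) (Σ⟨ z ∷ ys ⟩ m) (Σ⟨ z ∷ ys ⟩ (λ x → m x * m x)) (m y)
          (P-pos Py) (P-squares Pys) q≤ (P-squares Py)
          (P⇒Large j z ys (suc-injective (suc-injective (trans (sym (↭-length perm)) (cong suc len)))) Pys))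
      where
      Py : P (y ∷ z ∷ ys)
      Py = P-↭ perm Px
      Pys : P (z ∷ ys)
      Pys = P-tail Py
      q≤ : Σ⟨ z ∷ ys ⟩ (λ x → m x * m x) ≤ m y * Σ⟨ z ∷ ys ⟩ m
      q≤ = ≤-trans (Σ-mono-∈ (z ∷ ys) (λ {x} x∈ → *-monoˡ-≤ (m x) (All.lookup ub x∈)))
                   (≤-reflexive (Σ-*ˡ (m y) m (z ∷ ys)))

    P⇒exponential : ∀ xs → P xs → ∀ {n} → 1 ≤ n → Σ⟨ xs ⟩ m ≤ n → 2 ^ length xs ≤ 4 * n
    P⇒exponential [] _ 1≤n _ = ≤-trans 1≤n (m≤n*m _ 4)
    P⇒exponential (x ∷ xs) Px _ σ≤n =
      ≤-trans (Large⇒≤ (2 ^ suc (length xs)) (Σ⟨ x ∷ xs ⟩ m) (Σ⟨ x ∷ xs ⟩ (λ x → m x * m x)) (P-squares Px) (P⇒Large (length xs) x xs refl Px)) (*-monoʳ-≤ 4 σ≤n)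

length-filter-¬ : ∀ {A : Set} {P : A → Set} (P? : Decidable P) xs →
                  length (filter P? xs) + length (filter (¬? ∘ P?) xs) ≡ length xs
length-filter-¬ P? [] = refl
length-filter-¬ P? (x ∷ xs) with P? x
... | yes _ = cong suc (length-filter-¬ P? xs)
... | no _  = trans (+-suc _ _) (cong suc (length-filter-¬ P? xs))

-- Light and heavy colours

module _ {n k : ℕ} (3≤n : 3 ≤ n) (G : Fin k → Fin n → Fin n → Bool)
         (G-sym : ∀ t → Symm (G t))
         (exclusive : ∀ {s t a b} → s ≢ t → a ≢ b → G s a b ≡ true ⊎ G t a b ≡ true)
         (i : Fin k → ℕ) (S : Fin k → Fin n → Bool)
         (manySmall : ∀ t → ManySmallDegrees (G t) (i t) (S t)) where

  private
    m : Fin k → ℕ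
    m t = ∑ (⟦_⟧ ∘ S t)

    i≤m : ∀ t → i t ≤ m t
    i≤m t = proj₁ (proj₂ (proj₂ (manySmall t)))

    -- Chvátal's condition only gives 2i < n. The case left out here is 2i + 1 = n, in which the
    -- sets of two colours may share vertices.
    Light : Fin k → Set
    Light t = 2 + 2 * i t ≤ n

    light? : ∀ t → Dec (Light t)
    light? t = 2 + 2 * i t ≤? n

    covered : ∀ {s t} → s ≢ t → ∀ a → n ≤ deg (G s) a + deg (G t) a + 1
    covered {s} {t} s≢t a = begin
      n
        ≡⟨ trans (∑-const n 1) (*-identityʳ n) ⟨
      ∑ {n} (λ _ → 1)
        ≤⟨ Σ-mono (allFin n) pointwise ⟩
      ∑ (λ b → ⟦ G s a b ⟧ + ⟦ G t a b ⟧ + ⟦ does (b F.≟ a) ⟧)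
        ≡⟨ Σ-+ (λ b → ⟦ G s a b ⟧ + ⟦ G t a b ⟧) _ (allFin n) ⟩
      ∑ (λ b → ⟦ G s a b ⟧ + ⟦ G t a b ⟧) + ∑ (λ b → ⟦ does (b F.≟ a) ⟧)
        ≡⟨ cong₂ _+_ (Σ-+ (⟦_⟧ ∘ G s a) _ (allFin n)) (∑-≟ a) ⟩
      deg (G s) a + deg (G t) a + 1 ∎
      where
      open ≤-Reasoning
      pointwise : ∀ b → 1 ≤ ⟦ G s a b ⟧ + ⟦ G t a b ⟧ + ⟦ does (b F.≟ a) ⟧
      pointwise b with b F.≟ a
      ... | yes _ = m≤n+m 1 _
      ... | no b≢a with exclusive s≢t (b≢a ∘ sym)
      ...   | inj₁ e rewrite e = s≤s z≤n
      ...   | inj₂ e rewrite e = ≤-trans (m≤n+m 1 ⟦ G s a b ⟧) (m≤m+n _ 0)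

    -- The n - 1 other vertices are all neighbours of a common vertex in `G s` or in `G t`, so n - 1
    -- ≤ i s + i t, whereas lightness gives i s + i t ≤ n - 2.
    disjoint : ∀ {s t} → Light s → Light t → ∀ {a} → S s a ≡ true → S t a ≡ true → s ≡ t
    disjoint {s} {t} ls lt {a} as at with s F.≟ t
    ... | yes s≡t = s≡t
    ... | no s≢t = contradiction (+-mono-≤ ls lt) (<⇒≱ (begin-strict
      n + n                         ≤⟨ +-mono-≤ n≤ n≤ ⟩
      i s + i t + 1 + (i s + i t + 1) ≡⟨ double (i s) (i t) ⟩
      2 + (2 * i s + 2 * i t)       <⟨ m≤n⇒m≤1+n ≤-refl ⟩
      4 + (2 * i s + 2 * i t)       ≡⟨ split (2 * i s) (2 * i t) ⟩
      2 + 2 * i s + (2 + 2 * i t)   ∎))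
      where
      open ≤-Reasoning
      small : ∀ t → S t a ≡ true → deg (G t) a ≤ i t
      small t = proj₂ (proj₂ (proj₂ (manySmall t))) a
      n≤ : n ≤ i s + i t + 1
      n≤ = ≤-trans (covered s≢t a) (+-monoˡ-≤ 1 (+-mono-≤ (small s as) (small t at)))
      double : ∀ a b → a + b + 1 + (a + b + 1) ≡ 2 + (2 * a + 2 * b)
      double = solve-∀
      split : ∀ a b → 4 + (a + b) ≡ 2 + a + (2 + b)
      split = solve-∀

    LightColours : List (Fin k) → Set
    LightColours l = Unique l × All Light l

    atMostOneLight : ∀ {l} → LightColours l → ∀ b → Σ⟨ l ⟩ (λ t → ⟦ S t b ⟧) ≤ 1
    atMostOneLight (u , ls) b = Σ-atMostOne (λ t → S t b) u
      λ s∈ t∈ → disjoint (All.lookup ls s∈) (All.lookup ls t∈)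

    -- Counts the pairs in `S s` × `S t` related by `g`. For g = `λ _ → S s` and s = t this is (m
    -- s)², so the diagonal of (Σ m)² is handled like the edges of `G s` and of `G t`. These three
    -- families make the factor 3.
    W : (Fin n → Fin n → Bool) → Fin k → Fin k → ℕ
    W g s t = ∑ (λ a → ∑ (λ b → ⟦ S s a ⟧ * (⟦ g a b ⟧ * ⟦ S t b ⟧)))

    -- For fixed `a`, each `b` lies in at most one of the disjoint sets `S t`, so the sum over `t`
    -- sees every `g`-neighbour of `a` at most once.
    W-sum : ∀ {l} → LightColours l → ∀ g s → (∀ a → S s a ≡ true → ∑ (⟦_⟧ ∘ g a) ≤ m s) →
            Σ⟨ l ⟩ (W g s) ≤ m s * m s
    W-sum {l} L g s few = begin
      Σ⟨ l ⟩ (λ t → ∑ (λ a → ∑ (λ b → ⟦ S s a ⟧ * (⟦ g a b ⟧ * ⟦ S t b ⟧))))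
        ≡⟨ Σ-swap _ l (allFin n) ⟩
      ∑ (λ a → Σ⟨ l ⟩ (λ t → ∑ (λ b → ⟦ S s a ⟧ * (⟦ g a b ⟧ * ⟦ S t b ⟧))))
        ≡⟨ Σ-cong (allFin n) (λ a → Σ-swap _ l (allFin n)) ⟩
      ∑ (λ a → ∑ (λ b → Σ⟨ l ⟩ (λ t → ⟦ S s a ⟧ * (⟦ g a b ⟧ * ⟦ S t b ⟧))))
        ≤⟨ Σ-mono (allFin n) (λ a → Σ-mono (allFin n) (λ b → pointwise a b)) ⟩
      ∑ (λ a → ∑ (λ b → ⟦ S s a ⟧ * ⟦ g a b ⟧))
        ≡⟨ Σ-cong (allFin n) (λ a → Σ-*ˡ ⟦ S s a ⟧ (⟦_⟧ ∘ g a) (allFin n)) ⟩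
      ∑ (λ a → ⟦ S s a ⟧ * ∑ (⟦_⟧ ∘ g a))
        ≤⟨ Σ-mono (allFin n) row ⟩
      ∑ (λ a → ⟦ S s a ⟧ * m s)
        ≡⟨ Σ-*ʳ (m s) (⟦_⟧ ∘ S s) (allFin n) ⟩
      m s * m s ∎
      where
      open ≤-Reasoning
      pointwise : ∀ a b → Σ⟨ l ⟩ (λ t → ⟦ S s a ⟧ * (⟦ g a b ⟧ * ⟦ S t b ⟧)) ≤ ⟦ S s a ⟧ * ⟦ g a b ⟧
      pointwise a b = begin
        Σ⟨ l ⟩ (λ t → ⟦ S s a ⟧ * (⟦ g a b ⟧ * ⟦ S t b ⟧))
          ≡⟨ trans (Σ-*ˡ ⟦ S s a ⟧ _ l) (cong (⟦ S s a ⟧ *_) (Σ-*ˡ ⟦ g a b ⟧ _ l)) ⟩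
        ⟦ S s a ⟧ * (⟦ g a b ⟧ * Σ⟨ l ⟩ (λ t → ⟦ S t b ⟧))
          ≤⟨ *-monoʳ-≤ ⟦ S s a ⟧ (*-monoʳ-≤ ⟦ g a b ⟧ (atMostOneLight L b)) ⟩
        ⟦ S s a ⟧ * (⟦ g a b ⟧ * 1)
          ≡⟨ cong (⟦ S s a ⟧ *_) (*-identityʳ ⟦ g a b ⟧) ⟩
        ⟦ S s a ⟧ * ⟦ g a b ⟧ ∎
      row : ∀ a → ⟦ S s a ⟧ * ∑ (⟦_⟧ ∘ g a) ≤ ⟦ S s a ⟧ * m s
      row a with S s a in e
      ... | true = *-monoʳ-≤ 1 (few a e)
      ... | false = z≤n

    product≤W : ∀ {s t} → Light s → Light t → m s * m t ≤ W (G s) s t + W (G t) t s + W (λ _ → S s) s t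
    product≤W {s} {t} ls lt = begin
      m s * m t
        ≡⟨ Σ-*ʳ (m t) (⟦_⟧ ∘ S s) (allFin n) ⟨
      ∑ (λ a → ⟦ S s a ⟧ * m t)
        ≡⟨ Σ-cong (allFin n) (λ a → sym (Σ-*ˡ ⟦ S s a ⟧ (⟦_⟧ ∘ S t) (allFin n))) ⟩
      ∑ (λ a → ∑ (λ b → ⟦ S s a ⟧ * ⟦ S t b ⟧))
        ≤⟨ Σ-mono (allFin n) (λ a → Σ-mono (allFin n) (λ b → pointwise a b)) ⟩
      ∑ (λ a → ∑ (λ b → f a b + g b a + h a b))
        ≡⟨ Σ-cong (allFin n) (λ a → trans (Σ-+ (λ b → f a b + g b a) (h a) (allFin n))
             (cong (_+ ∑ (h a)) (Σ-+ (f a) (λ b → g b a) (allFin n)))) ⟩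
      ∑ (λ a → ∑ (f a) + ∑ (λ b → g b a) + ∑ (h a))
        ≡⟨ trans (Σ-+ (λ a → ∑ (f a) + ∑ (λ b → g b a)) _ (allFin n))
             (cong (_+ W (λ _ → S s) s t) (Σ-+ (λ a → ∑ (f a)) _ (allFin n))) ⟩
      W (G s) s t + ∑ (λ a → ∑ (λ b → g b a)) + W (λ _ → S s) s t
        ≡⟨ cong (λ z → W (G s) s t + z + W (λ _ → S s) s t) (Σ-swap (λ a b → g b a) (allFin n) (allFin n)) ⟩
      W (G s) s t + W (G t) t s + W (λ _ → S s) s t ∎
      where
      open ≤-Reasoning
      f g h : Fin n → Fin n → ℕ
      f a b = ⟦ S s a ⟧ * (⟦ G s a b ⟧ * ⟦ S t b ⟧)
      g b a = ⟦ S t b ⟧ * (⟦ G t b a ⟧ * ⟦ S s a ⟧)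
      h a b = ⟦ S s a ⟧ * (⟦ S s b ⟧ * ⟦ S t b ⟧)
      pointwise : ∀ a b → ⟦ S s a ⟧ * ⟦ S t b ⟧ ≤ f a b + g b a + h a b
      pointwise a b with S s a in as | S t b in bt
      ... | false | _ = z≤n
      ... | true | false = z≤n
      ... | true | true with s F.≟ t
      ...   | yes refl rewrite bt = m≤n+m 1 _
      ...   | no s≢t with a F.≟ b
      ...     | yes refl = contradiction (disjoint ls lt as bt) s≢t
      ...     | no a≢b with exclusive s≢t a≢b
      ...       | inj₁ e rewrite e = s≤s z≤n
      ...       | inj₂ e rewrite trans (G-sym t b a) e =
        ≤-trans (m≤n+m 1 (1 * (⟦ G s a b ⟧ * 1))) (m≤m+n _ _)

    squares : ∀ {l} → LightColours l → Σ⟨ l ⟩ m * Σ⟨ l ⟩ m ≤ 3 * Σ⟨ l ⟩ (λ t → m t * m t)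
    squares {l} L@(_ , ls) = begin
      Σ⟨ l ⟩ m * Σ⟨ l ⟩ m
        ≡⟨ Σ-*ʳ (Σ⟨ l ⟩ m) m l ⟨
      Σ⟨ l ⟩ (λ s → m s * Σ⟨ l ⟩ m)
        ≡⟨ Σ-cong l (λ s → sym (Σ-*ˡ (m s) m l)) ⟩
      Σ⟨ l ⟩ (λ s → Σ⟨ l ⟩ (λ t → m s * m t))
        ≤⟨ Σ-mono-∈ l (λ s∈ → Σ-mono-∈ l (λ t∈ → product≤W (All.lookup ls s∈) (All.lookup ls t∈))) ⟩
      Σ⟨ l ⟩ (λ s → Σ⟨ l ⟩ (λ t → f s t + f t s + h s t))
        ≡⟨ Σ-cong l (λ s → trans (Σ-+ (λ t → f s t + f t s) (h s) l)
             (cong (_+ Σ⟨ l ⟩ (h s)) (Σ-+ (f s) (λ t → f t s) l))) ⟩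
      Σ⟨ l ⟩ (λ s → Σ⟨ l ⟩ (f s) + Σ⟨ l ⟩ (λ t → f t s) + Σ⟨ l ⟩ (h s))
        ≡⟨ trans (Σ-+ (λ s → Σ⟨ l ⟩ (f s) + Σ⟨ l ⟩ (λ t → f t s)) _ l)
             (cong (_+ Σ⟨ l ⟩ (λ s → Σ⟨ l ⟩ (h s))) (Σ-+ (λ s → Σ⟨ l ⟩ (f s)) _ l)) ⟩
      Σ⟨ l ⟩ (λ s → Σ⟨ l ⟩ (f s)) + Σ⟨ l ⟩ (λ s → Σ⟨ l ⟩ (λ t → f t s)) + Σ⟨ l ⟩ (λ s → Σ⟨ l ⟩ (h s))
        ≡⟨ cong (λ z → Σ⟨ l ⟩ (λ s → Σ⟨ l ⟩ (f s)) + z + Σ⟨ l ⟩ (λ s → Σ⟨ l ⟩ (h s))) (Σ-swap (λ s t → f t s) l l) ⟩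
      Σ⟨ l ⟩ (λ s → Σ⟨ l ⟩ (f s)) + Σ⟨ l ⟩ (λ s → Σ⟨ l ⟩ (f s)) + Σ⟨ l ⟩ (λ s → Σ⟨ l ⟩ (h s))
        ≤⟨ +-mono-≤ (+-mono-≤ f≤ f≤) (Σ-mono l (λ s → W-sum L (λ _ → S s) s (λ _ _ → ≤-refl))) ⟩
      q + q + q
        ≡⟨ thrice q ⟩
      3 * q ∎
      where
      open ≤-Reasoning
      q = Σ⟨ l ⟩ (λ t → m t * m t)
      f h : Fin k → Fin k → ℕ
      f s t = W (G s) s t
      h s t = W (λ _ → S s) s t
      f≤ : Σ⟨ l ⟩ (λ s → Σ⟨ l ⟩ (f s)) ≤ q
      f≤ = Σ-mono l (λ s → W-sum L (G s) s
        (λ a as → ≤-trans (proj₂ (proj₂ (proj₂ (manySmall s))) a as) (i≤m s)))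
      thrice : ∀ q → q + q + q ≡ 3 * q
      thrice = solve-∀

    light-count : ∀ {l} → LightColours l → 2 ^ length l ≤ 4 * n
    light-count {l} L = P⇒exponential m LightColours
      (λ { (_ ∷ u , _ ∷ ls) → u , ls })
      (λ p (u , ls) → Unique-resp-↭ (setoid (Fin k)) (↭⇒↭ₛ p) u , All-resp-↭ p ls)
      (λ {t} _ → ≤-trans (proj₁ (manySmall t)) (i≤m t))
      squares l L (≤-trans (s≤s z≤n) 3≤n) (begin
        Σ⟨ l ⟩ m
          ≡⟨ Σ-swap (λ t a → ⟦ S t a ⟧) l (allFin n) ⟩
        ∑ (λ a → Σ⟨ l ⟩ (λ t → ⟦ S t a ⟧))
          ≤⟨ Σ-mono (allFin n) (atMostOneLight L) ⟩
        ∑ {n} (λ _ → 1)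
          ≡⟨ trans (∑-const n 1) (*-identityʳ n) ⟩
        n ∎)
      where open ≤-Reasoning

    heavy⇒ : ∀ {t} → ¬ Light t → suc (2 * i t) ≡ n
    heavy⇒ {t} ¬l = ≤-antisym (proj₁ (proj₂ (manySmall t))) (s≤s⁻¹ (≰⇒> ¬l))

    -- A heavy colour t covers at least half of the degree at each of about n/2 vertices,
    -- hence a positive proportion of all pairs.
    heavy-count : ∀ {l} → Unique l → All (¬_ ∘ Light) l → length l ≤ 9
    heavy-count [] _ = z≤n
    heavy-count {l@(t₀ ∷ _)} u hs@(h₀ ∷ _) = *-cancelʳ-≤ (length l) 9 (h * h) (begin
      length l * (h * h)
        ≡⟨ Σ-const (h * h) l ⟨
      Σ⟨ l ⟩ (λ _ → h * h)
        ≤⟨ Σ-mono-∈ l (λ {t} t∈ → many t (same t∈)) ⟩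
      Σ⟨ l ⟩ (λ t → ∑ (λ a → ∑ (λ b → ⟦ E t a b ⟧)))
        ≡⟨ Σ-swap _ l (allFin n) ⟩
      ∑ (λ a → Σ⟨ l ⟩ (λ t → ∑ (λ b → ⟦ E t a b ⟧)))
        ≡⟨ Σ-cong (allFin n) (λ a → Σ-swap _ l (allFin n)) ⟩
      ∑ (λ a → ∑ (λ b → Σ⟨ l ⟩ (λ t → ⟦ E t a b ⟧)))
        ≤⟨ Σ-mono (allFin n) (λ a → Σ-mono (allFin n) (λ b → Σ-atMostOne (λ t → E t a b) u (λ _ _ → E-unique))) ⟩
      ∑ {n} (λ a → ∑ {n} (λ b → 1))
        ≡⟨ trans (∑-const n _) (cong (n *_) (trans (∑-const n 1) (*-identityʳ n))) ⟩
      n * n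
        ≤⟨ *-mono-≤ n≤3h n≤3h ⟩
      3 * h * (3 * h)
        ≡⟨ nine h ⟩
      9 * (h * h) ∎)
      where
      open ≤-Reasoning
      h = i t₀
      1≤h : 1 ≤ h
      1≤h = proj₁ (manySmall t₀)
      instance
        h²≢0 : NonZero (h * h)
        h²≢0 = >-nonZero (*-mono-≤ 1≤h 1≤h)
      nine : ∀ h → 3 * h * (3 * h) ≡ 9 * (h * h)
      nine = solve-∀
      -- From n = 2h + 1 and h ≥ 1. Each heavy colour claims at least h² of the n² ≤ 9h² ordered
      -- pairs, which gives the 9.
      n≤3h : n ≤ 3 * h
      n≤3h = ≤-trans (≤-reflexive (sym (heavy⇒ h₀))) (+-monoˡ-≤ (2 * h) 1≤h)
      same : ∀ {t} → t ∈ₗ l → i t ≡ h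
      same t∈ = *-cancelˡ-≡ _ _ 2 (suc-injective (trans (heavy⇒ (All.lookup hs t∈)) (sym (heavy⇒ h₀))))
      -- The pairs of distinct vertices missing from `G t`; by `exclusive` no pair is claimed by two
      -- colours. A vertex of `S t` lies in at least n - 1 - h = h of them.
      E : Fin k → Fin n → Fin n → Bool
      E t a b = not (G t a b ∨ does (b F.≟ a))
      E-unique : ∀ {s t a b} → E s a b ≡ true → E t a b ≡ true → s ≡ t
      E-unique {s} {t} {a} {b} es et with s F.≟ t
      ... | yes s≡t = s≡t
      ... | no s≢t with G s a b in gs | G t a b in gt | b F.≟ a
      ...   | false | false | no b≢a with exclusive s≢t (b≢a ∘ sym)
      ...     | inj₁ e = contradiction (trans (sym gs) e) λ ()
      ...     | inj₂ e = contradiction (trans (sym gt) e) λ ()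
      row : ∀ t a → i t ≡ h → S t a ≡ true → h ≤ ∑ (λ b → ⟦ E t a b ⟧)
      row t a it at = +-cancelʳ-≤ (i t + 1) _ _ (begin
        h + (i t + 1)
          ≡⟨ trans (cong (λ z → h + (z + 1)) it) (arith h) ⟩
        suc (2 * h)
          ≡⟨ heavy⇒ h₀ ⟩
        n
          ≡⟨ trans (∑-const n 1) (*-identityʳ n) ⟨
        ∑ {n} (λ _ → 1)
          ≤⟨ Σ-mono (allFin n) pointwise ⟩
        ∑ (λ b → ⟦ E t a b ⟧ + (⟦ G t a b ⟧ + ⟦ does (b F.≟ a) ⟧))
          ≡⟨ trans (Σ-+ (⟦_⟧ ∘ E t a) _ (allFin n)) (cong (∑ (⟦_⟧ ∘ E t a) +_) (Σ-+ (⟦_⟧ ∘ G t a) _ (allFin n))) ⟩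
        ∑ (⟦_⟧ ∘ E t a) + (deg (G t) a + ∑ (λ b → ⟦ does (b F.≟ a) ⟧))
          ≤⟨ +-monoʳ-≤ (∑ (⟦_⟧ ∘ E t a)) (+-mono-≤ (proj₂ (proj₂ (proj₂ (manySmall t))) a at) (≤-reflexive (∑-≟ a))) ⟩
        ∑ (⟦_⟧ ∘ E t a) + (i t + 1) ∎)
        where
        arith : ∀ h → h + (h + 1) ≡ suc (2 * h)
        arith = solve-∀
        pointwise : ∀ b → 1 ≤ ⟦ E t a b ⟧ + (⟦ G t a b ⟧ + ⟦ does (b F.≟ a) ⟧)
        pointwise b with G t a b | does (b F.≟ a)
        ... | true | _ = s≤s z≤n
        ... | false | true = s≤s z≤n
        ... | false | false = s≤s z≤n
      many : ∀ t → i t ≡ h → h * h ≤ ∑ (λ a → ∑ (λ b → ⟦ E t a b ⟧))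
      many t it = begin
        h * h
          ≤⟨ *-monoˡ-≤ h (≤-trans (≤-reflexive (sym it)) (i≤m t)) ⟩
        m t * h
          ≡⟨ Σ-*ʳ h (⟦_⟧ ∘ S t) (allFin n) ⟨
        ∑ (λ a → ⟦ S t a ⟧ * h)
          ≤⟨ Σ-mono (allFin n) perVertex ⟩
        ∑ (λ a → ∑ (λ b → ⟦ E t a b ⟧)) ∎
        where
        perVertex : ∀ a → ⟦ S t a ⟧ * h ≤ ∑ (λ b → ⟦ E t a b ⟧)
        perVertex a with S t a in at
        ... | false = z≤n
        ... | true = ≤-trans (≤-reflexive (+-identityʳ h)) (row t a it at)

  -- The summand 11 is 2 + 9: if there are r light colours, then 2^r ≤ 4n, and at most nine colours
  -- are heavy.
  manySmall⇒fewColours : k ≤ ⌊log₂ n ⌋ + 11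
  manySmall⇒fewColours = begin
    k
      ≡⟨ length-tabulate {n = k} id ⟨
    length (allFin k)
      ≡⟨ length-filter-¬ light? (allFin k) ⟨
    length lights + length (filter (¬? ∘ light?) (allFin k))
      ≤⟨ +-mono-≤ lights≤ (heavy-count (filter⁺ (¬? ∘ light?) (allFin⁺ k)) (all-filter (¬? ∘ light?) (allFin k))) ⟩
    2 + ⌊log₂ n ⌋ + 9
      ≡⟨ shuffle ⌊log₂ n ⌋ ⟩
    ⌊log₂ n ⌋ + 11 ∎
    where
    open ≤-Reasoning
    lights = filter light? (allFin k)
    shuffle : ∀ x → 2 + x + 9 ≡ x + 11
    shuffle = solve-∀
    instance
      n≢0 : NonZero n
      n≢0 = >-nonZero (≤-trans (s≤s z≤n) 3≤n)
      2n≢0 : NonZero (2 * n)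
      2n≢0 = m*n≢0 2 n
    lights≤ : length lights ≤ 2 + ⌊log₂ n ⌋
    lights≤ = begin
      length lights
        ≡⟨ ⌊log₂[2^n]⌋≡n (length lights) ⟨
      ⌊log₂ (2 ^ length lights) ⌋
        ≤⟨ ⌊log₂⌋-mono-≤ (light-count (filter⁺ light? (allFin⁺ k) , all-filter light? (allFin k))) ⟩
      ⌊log₂ (4 * n) ⌋
        ≡⟨ cong ⌊log₂_⌋ (*-assoc 2 2 n) ⟩
      ⌊log₂ (2 * (2 * n)) ⌋
        ≡⟨ trans (⌊log₂[2*b]⌋≡1+⌊log₂b⌋ (2 * n)) (cong suc (⌊log₂[2*b]⌋≡1+⌊log₂b⌋ n)) ⟩
      2 + ⌊log₂ n ⌋ ∎

-- Polychromatic numbers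

injective⇒surjective : ∀ {n} {σ : Fin n → Fin n} → Injective _≡_ _≡_ σ → ∀ v → ∃ λ i → σ i ≡ v
injective⇒surjective {suc n} {σ} inj v with FP.any? (λ i → σ i F.≟ v)
... | yes hit = hit
... | no miss = contradiction (FP.injective⇒≤ {f = avoid} avoid-injective) 1+n≰n
  where
  v≢σ : ∀ i → v ≢ σ i
  v≢σ i v≡ = miss (i , sym v≡)
  avoid : Fin (suc n) → Fin n
  avoid i = punchOut (v≢σ i)
  avoid-injective : Injective _≡_ _≡_ avoid
  avoid-injective {i} {j} eq = inj (FP.punchOut-injective (v≢σ i) (v≢σ j) eq)

unique⇒lookup-injective : ∀ {A : Set} {xs : List A} → Unique xs → Injective _≡_ _≡_ (lookup xs)
unique⇒lookup-injective (_ ∷ _) {zero} {zero} _ = refl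
unique⇒lookup-injective {xs = _ ∷ xs} (x# ∷ _) {zero} {suc j} eq = contradiction eq (All.lookup x# (∈-lookup j))
unique⇒lookup-injective {xs = _ ∷ xs} (x# ∷ _) {suc i} {zero} eq = contradiction (sym eq) (All.lookup x# (∈-lookup i))
unique⇒lookup-injective (_ ∷ u) {suc i} {suc j} eq = cong suc (unique⇒lookup-injective u eq)

∈-tabulate⁺ : ∀ {n} {f : Fin n → Bool} {v} → f v ≡ true → v ∈ Vec.tabulate f
∈-tabulate⁺ {f = f} {v} e = VP.lookup⇒[]= v _ (trans (VP.lookup∘tabulate f v) e)

∈-tabulate⁻ : ∀ {n} {f : Fin n → Bool} {v} → v ∈ Vec.tabulate f → f v ≡ true
∈-tabulate⁻ {f = f} {v} v∈ = trans (sym (VP.lookup∘tabulate f v)) (VP.[]=⇒lookup v∈)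

any-edge? : ∀ {n} {Q : Edge n → Set} → (∀ e → Dec (Q e)) → Dec (∃ Q)
any-edge? {n} {Q} Q? = map′ (λ { (u , v , p , q) → ((u , v) , p) , q }) (λ { (((u , v) , p) , q) → u , v , p , q })
  (FP.any? λ u → FP.any? λ v → withOrder u v)
  where
  withOrder : ∀ u v → Dec (∃ λ p → Q ((u , v) , p))
  withOrder u v with u F.<? v
  ... | no u≮v = no λ { (p , _) → u≮v p }
  -- Proofs of u < v are equal, so a single one decides for the pair.
  ... | yes p = map′ (p ,_) (λ { (p′ , q) → subst (λ p → Q ((u , v) , p)) (<-irrelevant p′ p) q }) (Q? ((u , v) , p))

module _ {n : ℕ} where

  cyclicNext? : ∀ i j → Dec (CyclicNext n i j)
  cyclicNext? i j = (suc (toℕ i) ≟ toℕ j) ⊎-dec (suc (toℕ i) ≟ n ×-dec toℕ j ≟ 0)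

  next : ∀ i → ∃ λ j → CyclicNext n i j
  next i with suc (toℕ i) <? n
  ... | yes lt = fromℕ< lt , inj₁ (sym (FP.toℕ-fromℕ< lt))
  ... | no ≮n = fromℕ< 0<n , inj₂ (≤-antisym (FP.toℕ<n i) (≮⇒≥ ≮n) , FP.toℕ-fromℕ< 0<n)
    where
    0<n : 0 < n
    0<n = ≤-trans (s≤s z≤n) (FP.toℕ<n i)

  next-functional : ∀ {i j k} → CyclicNext n i j → CyclicNext n i k → j ≡ k
  next-functional (inj₁ p) (inj₁ q) = FP.toℕ-injective (trans (sym p) q)
  next-functional {j = j} (inj₁ p) (inj₂ (q , _)) = contradiction (trans (sym p) q) (<⇒≢ (FP.toℕ<n j))
  next-functional {k = k} (inj₂ (p , _)) (inj₁ q) = contradiction (trans (sym q) p) (<⇒≢ (FP.toℕ<n k))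
  next-functional (inj₂ (_ , p)) (inj₂ (_ , q)) = FP.toℕ-injective (trans p (sym q))

  next-injective : ∀ {i j k} → CyclicNext n i k → CyclicNext n j k → i ≡ j
  next-injective (inj₁ p) (inj₁ q) = FP.toℕ-injective (suc-injective (trans p (sym q)))
  next-injective (inj₁ p) (inj₂ (_ , q)) = contradiction (trans p q) λ ()
  next-injective (inj₂ (_ , p)) (inj₁ q) = contradiction (trans q p) λ ()
  next-injective (inj₂ (p , _)) (inj₂ (q , _)) = FP.toℕ-injective (suc-injective (trans p (sym q)))

  next-irreflexive : 3 ≤ n → ∀ {i} → ¬ CyclicNext n i i
  next-irreflexive _ (inj₁ p) = 1+n≢n p
  next-irreflexive 3≤n (inj₂ (p , q)) with refl ← trans (sym p) (cong suc q) | s≤s () ← 3≤n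

  next-asymmetric : 3 ≤ n → ∀ {i j} → CyclicNext n i j → ¬ CyclicNext n j i
  next-asymmetric _ (inj₁ p) (inj₁ q) = contradiction (trans (cong suc p) q) (<⇒≢ (m≤n⇒m≤1+n ≤-refl) ∘ sym)
  next-asymmetric 3≤n (inj₁ p) (inj₂ (q , r))
    with refl ← trans (sym q) (cong suc (trans (sym p) (cong suc r))) | s≤s (s≤s ()) ← 3≤n
  next-asymmetric 3≤n (inj₂ (p , q)) (inj₁ r)
    with refl ← trans (sym p) (cong suc (trans (sym r) (cong suc q))) | s≤s (s≤s ()) ← 3≤n
  next-asymmetric 3≤n (inj₂ (p , q)) (inj₂ (_ , r)) with refl ← trans (sym p) (cong suc r) | s≤s () ← 3≤n

prev : ∀ {n} (i : Fin n) → ∃ λ j → CyclicNext n j i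
prev {suc n} zero = fromℕ n , inj₂ (cong suc (FP.toℕ-fromℕ n) , refl)
prev (suc i) = inject₁ i , inj₁ (cong suc (FP.toℕ-inject₁ i))

module _ {n : ℕ} (3≤n : 3 ≤ n) where

  Step : (Fin n → Fin n) → Fin n → Fin n → Set
  Step σ u v = ∃ λ i → ∃ λ j → CyclicNext n i j × ((σ i ≡ u × σ j ≡ v) ⊎ (σ i ≡ v × σ j ≡ u))

  step? : ∀ σ u v → Dec (Step σ u v)
  step? σ u v = FP.any? λ i → FP.any? λ j → cyclicNext? i j ×-dec
    ((σ i F.≟ u ×-dec σ j F.≟ v) ⊎-dec (σ i F.≟ v ×-dec σ j F.≟ u))

  cycleGraph : (Fin n → Fin n) → Graph n
  cycleGraph σ u = Vec.tabulate (λ v → does (step? σ u v))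

  step⇒∈ : ∀ σ {u v} → Step σ u v → v ∈ cycleGraph σ u
  step⇒∈ σ {u} {v} s = ∈-tabulate⁺ (dec-true (step? σ u v) s)

  ∈⇒step : ∀ σ {u v} → v ∈ cycleGraph σ u → Step σ u v
  ∈⇒step σ {u} {v} v∈ = does-sound (step? σ u v) (∈-tabulate⁻ v∈)

  cycleGraph-HC : ∀ {σ} → Injective _≡_ _≡_ σ → IsHamCycle (cycleGraph σ)
  cycleGraph-HC {σ} inj =
    ((λ u v v∈ → let i , j , nx , or = ∈⇒step σ v∈ in step⇒∈ σ (i , j , nx , Sum.swap or)) ,
     (λ v v∈ → loop (∈⇒step σ v∈))) ,
    σ , inj , (λ u v → ∈⇒step σ) , (λ i j nx → step⇒∈ σ (i , j , nx , inj₁ (refl , refl)))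
    where
    loop : ∀ {v} → ¬ Step σ v v
    loop (i , j , nx , inj₁ (p , q)) with refl ← inj (trans p (sym q)) = next-irreflexive 3≤n nx
    loop (i , j , nx , inj₂ (p , q)) with refl ← inj (trans p (sym q)) = next-irreflexive 3≤n nx

  -- The neighbours of `σ i` are the images of the next and the previous index, which differ because
  -- n ≥ 3.
  HC⊆F₂ : ∀ {A} → IsHamCycle A → IsTwoFactor A
  HC⊆F₂ {A} (simple@(symm , _) , σ , inj , edges , steps) = simple , degree
    where
    degree : ∀ v → ∣ A v ∣ ≡ 2
    degree v with i , refl ← injective⇒surjective inj v = begin
      ∣ A (σ i) ∣
        ≡⟨ ∣∣≡∑ (A (σ i)) ⟩
      ∑ (λ w → ⟦ Vec.lookup (A (σ i)) w ⟧)
        ≡⟨ Σ-cong (allFin n) pointwise ⟩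
      ∑ (λ w → ⟦ does (w F.≟ σ a) ⟧ + ⟦ does (w F.≟ σ b) ⟧)
        ≡⟨ Σ-+ _ _ (allFin n) ⟩
      ∑ (λ w → ⟦ does (w F.≟ σ a) ⟧) + ∑ (λ w → ⟦ does (w F.≟ σ b) ⟧)
        ≡⟨ cong₂ _+_ (∑-≟ (σ a)) (∑-≟ (σ b)) ⟩
      2 ∎
      where
      open ≡-Reasoning
      a = proj₁ (next i)
      b = proj₁ (prev i)
      ia = proj₂ (next i)
      bi = proj₂ (prev i)
      neighbour : ∀ {w} → w ∈ A (σ i) → w ≡ σ a ⊎ w ≡ σ b
      neighbour {w} w∈ with edges (σ i) w w∈
      ... | i′ , j′ , nx , inj₁ (p , q) with refl ← inj p = inj₁ (trans (sym q) (cong σ (next-functional nx ia)))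
      ... | i′ , j′ , nx , inj₂ (p , q) with refl ← inj q = inj₂ (trans (sym p) (cong σ (next-injective nx bi)))
      pointwise : ∀ w → ⟦ Vec.lookup (A (σ i)) w ⟧ ≡ ⟦ does (w F.≟ σ a) ⟧ + ⟦ does (w F.≟ σ b) ⟧
      pointwise w with w F.≟ σ a | w F.≟ σ b
      ... | yes p | yes q =
        contradiction (subst (λ z → CyclicNext n z i) (inj (trans (sym q) p)) bi) (next-asymmetric 3≤n ia)
      ... | yes refl | no _ rewrite VP.[]=⇒lookup (steps i a ia) = refl
      ... | no _ | yes refl rewrite VP.[]=⇒lookup (symm (σ b) (σ i) (steps b i bi)) = refl
      ... | no ≢a | no ≢b with Vec.lookup (A (σ i)) w in e
      ...   | false = refl
      ...   | true with neighbour (VP.lookup⇒[]= w (A (σ i)) e)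
      ...     | inj₁ p = contradiction p ≢a
      ...     | inj₂ p = contradiction p ≢b

  identityCycle : IsHamCycle (cycleGraph id)
  identityCycle = cycleGraph-HC id

  module _ {k : ℕ} (f : Edge n → Fin k) where

    -- An `Edge` stores its smaller end first; this reads the colour of a pair in either order.
    Coloured : Fin n → Fin n → Fin k → Set
    Coloured u v c = ∃ λ e → f e ≡ c × (proj₁ e ≡ (u , v) ⊎ proj₁ e ≡ (v , u))

    coloured? : ∀ u v c → Dec (Coloured u v c)
    coloured? u v c = any-edge? λ e → f e F.≟ c ×-dec
      (≡-dec F._≟_ F._≟_ (proj₁ e) (u , v) ⊎-dec ≡-dec F._≟_ F._≟_ (proj₁ e) (v , u))

    coloured-sym : ∀ {u v c} → Coloured u v c → Coloured v u c
    coloured-sym (e , fe , or) = e , fe , Sum.swap or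

    coloured-unique : ∀ {u v c d} → Coloured u v c → Coloured u v d → c ≡ d
    coloured-unique ((_ , p) , refl , inj₁ refl) ((_ , q) , refl , inj₁ refl) = cong (λ p → f (_ , p)) (<-irrelevant p q)
    coloured-unique ((_ , p) , refl , inj₁ refl) ((_ , q) , refl , inj₂ refl) = contradiction p (<-asym q)
    coloured-unique ((_ , p) , refl , inj₂ refl) ((_ , q) , refl , inj₁ refl) = contradiction p (<-asym q)
    coloured-unique ((_ , p) , refl , inj₂ refl) ((_ , q) , refl , inj₂ refl) = cong (λ p → f (_ , p)) (<-irrelevant p q)

    -- Orderings of the vertices replace graphs. They form a finite set to be searched, and they
    -- match the vertex lists in `Hamiltonian`.
    CyclePolychromatic : Set
    CyclePolychromatic = ∀ σ → Injective _≡_ _≡_ σ → ∀ c → ∃ λ i → ∃ λ j → CyclicNext n i j × Coloured (σ i) (σ j) c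

    HC-poly⇒cycle-poly : IsPolychromatic (HC n) f → CyclePolychromatic
    HC-poly⇒cycle-poly poly σ inj c
      with e , e∈ , fe ← poly (cycleGraph σ) (cycleGraph-HC inj) c with ∈⇒step σ e∈
    ... | i , j , nx , inj₁ (refl , refl) = i , j , nx , e , fe , inj₁ refl
    ... | i , j , nx , inj₂ (refl , refl) = i , j , nx , e , fe , inj₂ refl

    cycle-poly⇒HC-poly : CyclePolychromatic → IsPolychromatic (HC n) f
    cycle-poly⇒HC-poly poly A ((symm , _) , σ , inj , _ , steps) c with poly σ inj c
    ... | i , j , nx , e , fe , inj₁ refl = e , steps i j nx , fe
    ... | i , j , nx , e , fe , inj₂ refl = e , symm (σ i) (σ j) (steps i j nx) , fe

    F₂-poly⇒HC-poly : IsPolychromatic (F₂ n) f → IsPolychromatic (HC n) f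
    F₂-poly⇒HC-poly poly A hc = poly A (HC⊆F₂ hc)

    HC-poly⇒usesAll : IsPolychromatic (HC n) f → UsesAllColours f
    HC-poly⇒usesAll poly c = let e , _ , fe = poly _ identityCycle c in e , fe

    avoiding? : ∀ t u v → Dec (u ≢ v × ¬ Coloured u v t)
    avoiding? t u v = ¬? (u F.≟ v) ×-dec ¬? (coloured? u v t)

    avoiding : Fin k → Fin n → Fin n → Bool
    avoiding t u v = does (avoiding? t u v)

    avoiding-sym : ∀ t → Symm (avoiding t)
    avoiding-sym t u v = does-⇔ (mk⇔ flip flip) (avoiding? t u v) (avoiding? t v u)
      where
      flip : ∀ {u v} → u ≢ v × ¬ Coloured u v t → v ≢ u × ¬ Coloured v u t
      flip (u≢v , ¬c) = u≢v ∘ sym , ¬c ∘ coloured-sym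

    avoiding-irrefl : ∀ t a → avoiding t a a ≡ false
    avoiding-irrefl t a = dec-false (avoiding? t a a) λ { (a≢a , _) → a≢a refl }

    avoiding-exclusive : ∀ {s t a b} → s ≢ t → a ≢ b → avoiding s a b ≡ true ⊎ avoiding t a b ≡ true
    avoiding-exclusive {s} {t} {a} {b} s≢t a≢b = decide (coloured? a b s)
      where
      decide : Dec (Coloured a b s) → avoiding s a b ≡ true ⊎ avoiding t a b ≡ true
      decide (no ¬cs) = inj₁ (dec-true (avoiding? s a b) (a≢b , ¬cs))
      decide (yes cs) = inj₂ (dec-true (avoiding? t a b) (a≢b , λ ct → s≢t (coloured-unique cs ct)))

    avoiding-nonHamiltonian : IsPolychromatic (HC n) f → ∀ t → ¬ Hamiltonian (avoiding t)
    avoiding-nonHamiltonian poly t (x , l , perm , walk) =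
      let i , j , nx , c = HC-poly⇒cycle-poly poly σ σ-injective t
      in proj₂ (does-sound (avoiding? t (σ i) (σ j)) (σ-walk nx)) c
      where
      len : suc (length l) ≡ n
      len = ↭allFin⇒length perm
      σ : Fin n → Fin n
      σ i = lookup (x ∷ l) (F.cast (sym len) i)
      σ-injective : Injective _≡_ _≡_ σ
      σ-injective {i} {j} eq = FP.toℕ-injective (trans (sym (FP.toℕ-cast (sym len) i))
        (trans (cong toℕ (unique⇒lookup-injective (↭allFin⇒unique perm) eq)) (FP.toℕ-cast (sym len) j)))
      chain-lookup : ∀ {R : Fin n → Fin n → Set} {x y} l → Chain R x l y → ∀ (i j : Fin (suc (length l))) →
        suc (toℕ i) ≡ toℕ j → R (lookup (x ∷ l) i) (lookup (x ∷ l) j)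
      chain-lookup (z ∷ l) (r , _) zero (suc zero) refl = r
      chain-lookup (z ∷ l) (_ , c) (suc i) (suc j) eq = chain-lookup l c i j (suc-injective eq)
      chain-lookup [] _ zero zero ()
      chain-lookup (z ∷ l) _ zero (suc (suc j)) ()
      chain-last : ∀ {R : Fin n → Fin n → Set} {x y} l → Chain R x l y → ∀ (i : Fin (suc (length l))) →
        suc (toℕ i) ≡ suc (length l) → R (lookup (x ∷ l) i) y
      chain-last [] r zero _ = r
      chain-last (z ∷ l) (_ , c) (suc i) eq = chain-last l c i (suc-injective eq)
      σ-walk : ∀ {i j} → CyclicNext n i j → Adj (avoiding t) (σ i) (σ j)
      σ-walk {i} {j} (inj₁ p) = chain-lookup l walk _ _
        (trans (cong suc (FP.toℕ-cast (sym len) i)) (trans p (sym (FP.toℕ-cast (sym len) j))))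
      σ-walk {i} {j} (inj₂ (p , q)) =
        subst (λ z → Adj (avoiding t) (σ i) (lookup (x ∷ l) z))
          (FP.toℕ-injective {i = zero} (sym (trans (FP.toℕ-cast (sym len) j) q)))
          (chain-last l walk _ (trans (cong suc (FP.toℕ-cast (sym len) i)) (trans p (sym len))))

    HC-poly-bound : IsPolychromatic (HC n) f → k ≤ ⌊log₂ n ⌋ + 11
    HC-poly-bound poly = manySmall⇒fewColours 3≤n avoiding avoiding-sym avoiding-exclusive
      (λ t → proj₁ (witness t)) (λ t → proj₁ (proj₂ (witness t))) (λ t → proj₂ (proj₂ (witness t)))
      where
      witness : ∀ t → ∃ λ i → ∃ λ S → ManySmallDegrees (avoiding t) i S
      witness t = nonHamiltonian⇒manySmall 3≤n (avoiding t) (avoiding-sym t) (avoiding-irrefl t)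
        (avoiding-nonHamiltonian poly t)

    -- Only n^n functions have to be tested. Decoding returns `σ` up to pointwise equality, so the
    -- coloured edges are transported along `eq≗`.
    HC-poly? : Dec (IsPolychromatic (HC n) f)
    HC-poly? = map′ (cycle-poly⇒HC-poly ∘ fromAll) (toAll ∘ HC-poly⇒cycle-poly) (FP.all? λ i → poly? (finToFun i))
      where
      PolyAt : (Fin n → Fin n) → Set
      PolyAt σ = (∀ x y → σ x ≡ σ y → x ≡ y) → ∀ c → ∃ λ i → ∃ λ j → CyclicNext n i j × Coloured (σ i) (σ j) c
      poly? : ∀ σ → Dec (PolyAt σ)
      poly? σ = FP.all? (λ x → FP.all? λ y → σ x F.≟ σ y →-dec x F.≟ y) →-dec
        FP.all? λ c → FP.any? λ i → FP.any? λ j → cyclicNext? i j ×-dec coloured? (σ i) (σ j) c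
      toAll : CyclePolychromatic → ∀ i → PolyAt (finToFun i)
      toAll poly i inj = poly (finToFun i) (λ {x} {y} → inj x y)
      fromAll : (∀ i → PolyAt (finToFun i)) → CyclePolychromatic
      fromAll all σ inj c =
        let i , j , nx , col = all (funToFin σ) (λ x y eq → inj (trans (sym (eq≗ x)) (trans eq (eq≗ y)))) c
        in i , j , nx , subst₂ (λ u v → Coloured u v c) (eq≗ i) (eq≗ j) col
        where
        eq≗ : finToFun (funToFin σ) ≗ σ
        eq≗ = FP.finToFun-funToFin σ

    F₂-poly? : Dec (IsPolychromatic (F₂ n) f)
    F₂-poly? = map′ fromAll (λ poly i → poly (graph i)) (FP.all? λ i → poly? (graph i))
      where
      toBool : Fin 2 → Bool
      toBool zero = false
      toBool (suc _) = true
      fromBool : Bool → Fin 2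
      fromBool false = zero
      fromBool true = suc zero
      toBool∘fromBool : ∀ b → toBool (fromBool b) ≡ b
      toBool∘fromBool false = refl
      toBool∘fromBool true = refl
      PolyAt : Graph n → Set
      PolyAt A = IsTwoFactor A → ∀ c → ∃ λ e → e ∈E A × f e ≡ c
      poly? : ∀ A → Dec (PolyAt A)
      poly? A = (((FP.all? λ u → FP.all? λ v → v ∈? A u →-dec u ∈? A v) ×-dec FP.all? λ v → ¬? (v ∈? A v))
          ×-dec FP.all? λ v → ∣ A v ∣ ≟ 2)
        →-dec FP.all? λ c → any-edge? λ e → proj₂ (proj₁ e) ∈? A (proj₁ (proj₁ e)) ×-dec f e F.≟ c
      -- Graphs are coded as n by n matrices over `Fin 2`. Decoding is again faithful up to
      -- pointwise equality, under which `PolyAt` is invariant.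
      graph : Fin ((2 ^ n) ^ n) → Graph n
      graph i u = Vec.tabulate (λ v → toBool (finToFun (finToFun i u) v))
      code : Graph n → Fin ((2 ^ n) ^ n)
      code A = funToFin (λ u → funToFin (λ v → fromBool (Vec.lookup (A u) v)))
      graph∘code : ∀ A u → graph (code A) u ≡ A u
      graph∘code A u = trans (VP.tabulate-cong λ v → trans (cong toBool
          (trans (cong (λ z → finToFun z v) (FP.finToFun-funToFin (λ u → funToFin (λ v → fromBool (Vec.lookup (A u) v))) u))
            (FP.finToFun-funToFin (λ v → fromBool (Vec.lookup (A u) v)) v)))
          (toBool∘fromBool _))
        (VP.tabulate∘lookup (A u))
      PolyAt-resp : ∀ {A B} → (∀ u → A u ≡ B u) → PolyAt A → PolyAt B
      PolyAt-resp {A} {B} eq pa ((symm , irr) , two) c =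
        let e , e∈ , fe = pa (((λ u v v∈ → subst (u ∈_) (sym (eq v)) (symm u v (subst (v ∈_) (eq u) v∈))) ,
                               (λ v v∈ → irr v (subst (v ∈_) (eq v) v∈))) ,
                              (λ v → trans (cong ∣_∣ (eq v)) (two v))) c
        in e , subst (proj₂ (proj₁ e) ∈_) (eq (proj₁ (proj₁ e))) e∈ , fe
      fromAll : (∀ i → PolyAt (graph i)) → IsPolychromatic (F₂ n) f
      fromAll all A = PolyAt-resp (graph∘code A) (all (code A))

  any-colouring? : ∀ {k} {P : (Edge n → Fin k) → Set} → (∀ {f g} → f ≗ g → P f → P g) →
                   (∀ f → Dec (P f)) → Dec (∃ P)
  any-colouring? {k} {P} resp P? = map′ (λ { (i , p) → colouring i , p })
    (λ { (f , p) → code f , resp (sym ∘ colouring∘code f) p }) (FP.any? (P? ∘ colouring))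
    where
    colouring : Fin ((k ^ n) ^ n) → Edge n → Fin k
    colouring i ((u , v) , _) = finToFun (finToFun i u) v
    -- A table also needs entries at pairs that are not edges. As `Fin k` might be empty, the
    -- default is the colour of the edge between vertices 0 and 1.
    v₀ v₁ : Fin n
    v₀ = fromℕ< {0} (≤-trans (s≤s z≤n) 3≤n)
    v₁ = fromℕ< {1} (≤-trans (s≤s (s≤s z≤n)) 3≤n)
    v₀<v₁ : v₀ F.< v₁
    v₀<v₁ = ≤-reflexive (trans (cong suc (FP.toℕ-fromℕ< _)) (sym (FP.toℕ-fromℕ< _)))
    table : (Edge n → Fin k) → Fin n → Fin n → Fin k
    table f u v with u F.<? v
    ... | yes p = f ((u , v) , p)
    ... | no _ = f ((v₀ , v₁) , v₀<v₁)
    table-edge : ∀ f u v p → table f u v ≡ f ((u , v) , p)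
    table-edge f u v p with u F.<? v
    ... | yes q = cong (λ r → f ((u , v) , r)) (<-irrelevant q p)
    ... | no ≮ = contradiction p ≮
    code : (Edge n → Fin k) → Fin ((k ^ n) ^ n)
    code f = funToFin (λ u → funToFin (table f u))
    colouring∘code : ∀ f → colouring (code f) ≗ f
    colouring∘code f ((u , v) , p) = trans (cong (λ z → finToFun z v) (FP.finToFun-funToFin (λ u → funToFin (table f u)) u))
      (trans (FP.finToFun-funToFin (table f u) v) (table-edge f u v p))

  polychromatic-resp : ∀ {H : Family n} {k} {f g : Edge n → Fin k} → f ≗ g →
                       IsPolychromatic H f → IsPolychromatic H g
  polychromatic-resp eq poly A hA c = let e , e∈ , fe = poly A hA c in e , e∈ , trans (sym (eq e)) fe

-- Existence of the polychromatic numbers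

largest : ∀ {P : ℕ → Set} → (∀ k → Dec (P k)) → ∀ b → (∀ k → P k → k ≤ b) → ∀ {l} → P l →
          ∃ λ p → P p × (∀ k → P k → k ≤ p)
largest P? zero ub {l} Pl with refl ← n≤0⇒n≡0 (ub l Pl) = 0 , Pl , ub
largest P? (suc b) ub Pl with P? (suc b)
... | yes Pb = suc b , Pb , ub
... | no ¬Pb = largest P? b (λ k Pk → s≤s⁻¹ (≤∧≢⇒< (ub k Pk) (λ { refl → ¬Pb Pk }))) Pl

-- A family containing all Hamiltonian cycles inherits their upper bound, which bounds the search,
-- and the given colouring makes it succeed. The last component serves to compare the numbers of two
-- families.
polyNumber-exists : ∀ {n} → 3 ≤ n → (H : Family n) → (∀ {A} → IsHamCycle A → H A) →
  (∀ {k} (f : Edge n → Fin k) → Dec (IsPolychromatic H f)) →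
  ∀ {l} → (∃ λ (f : Edge n → Fin l) → IsPolychromatic H f) →
  ∃ λ p → IsPolyNumber n H p × (∀ k (f : Edge n → Fin k) → IsPolychromatic H f → k ≤ p)
polyNumber-exists {n} 3≤n H HC⊆H poly? start = package (largest
  (λ k → any-colouring? 3≤n (polychromatic-resp 3≤n) poly?) (⌊log₂ n ⌋ + 11)
  (λ k (f , poly) → HC-poly-bound 3≤n f (λ A hc → poly A (HC⊆H hc))) start)
  where
  Colourable : ℕ → Set
  Colourable k = ∃ λ (f : Edge n → Fin k) → IsPolychromatic H f
  package : (∃ λ p → Colourable p × (∀ k → Colourable k → k ≤ p)) →
            ∃ λ p → IsPolyNumber n H p × (∀ k (f : Edge n → Fin k) → IsPolychromatic H f → k ≤ p)
  package (p , (f , poly) , ub) =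
    p , ((f , HC-poly⇒usesAll 3≤n f (λ A hc → poly A (HC⊆H hc)) , poly) , λ k g _ polyg → ub k (g , polyg)) ,
    λ k g polyg → ub k (g , polyg)

-- Ordered colourings

module _ {n : ℕ} (g : Fin n → Fin n → Bool) (g-sym : Symm g) (two : ∀ u → ∑ (⟦_⟧ ∘ g u) ≡ 2) where

  twoNeighbours : ∀ x y → ¬ (∀ w → g x w ≡ true → toℕ w ≡ y)
  twoNeighbours x y h = contradiction (subst (_≤ 1) (two x) (Σ-atMostOne (g x) (allFin⁺ n)
    λ {v} {w} _ _ gv gw → FP.toℕ-injective (trans (h v gv) (sym (h w gw))))) λ { (s≤s ()) }

  module _ (P M : Fin n → Bool) (M→P : ∀ {v u} → M v ≡ true → g v u ≡ true → P u ≡ true) where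

    private
      out toM : Fin n → ℕ
      out u = ∑ (λ v → ⟦ P u ⟧ * ⟦ g u v ⟧)
      toM u = ∑ (λ v → ⟦ P u ⟧ * (⟦ M v ⟧ * ⟦ g u v ⟧))

      weight : ∀ (R : Fin n → Bool) u → ∑ (λ v → ⟦ R u ⟧ * ⟦ g u v ⟧) ≡ ⟦ R u ⟧ * 2
      weight R u = trans (Σ-*ˡ ⟦ R u ⟧ (⟦_⟧ ∘ g u) (allFin n)) (cong (⟦ R u ⟧ *_) (two u))

      ∑out : ∑ out ≡ ∑ (⟦_⟧ ∘ P) * 2
      ∑out = trans (Σ-cong (allFin n) (weight P)) (Σ-*ʳ 2 (⟦_⟧ ∘ P) (allFin n))

      ∑toM : ∑ (⟦_⟧ ∘ M) * 2 ≤ ∑ toM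
      ∑toM = begin
        ∑ (⟦_⟧ ∘ M) * 2
          ≡⟨ Σ-*ʳ 2 (⟦_⟧ ∘ M) (allFin n) ⟨
        ∑ (λ v → ⟦ M v ⟧ * 2)
          ≡⟨ Σ-cong (allFin n) (weight M) ⟨
        ∑ (λ v → ∑ (λ u → ⟦ M v ⟧ * ⟦ g v u ⟧))
          ≤⟨ Σ-mono (allFin n) (λ v → Σ-mono (allFin n) (pointwise v)) ⟩
        ∑ (λ v → ∑ (λ u → ⟦ P u ⟧ * (⟦ M v ⟧ * ⟦ g u v ⟧)))
          ≡⟨ Σ-swap (λ v u → ⟦ P u ⟧ * (⟦ M v ⟧ * ⟦ g u v ⟧)) (allFin n) (allFin n) ⟩
        ∑ toM ∎
        where
        open ≤-Reasoning
        pointwise : ∀ v u → ⟦ M v ⟧ * ⟦ g v u ⟧ ≤ ⟦ P u ⟧ * (⟦ M v ⟧ * ⟦ g u v ⟧)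
        pointwise v u with M v in mv | g v u in e
        ... | false | _ = z≤n
        ... | true | false = z≤n
        ... | true | true rewrite M→P mv e | trans (g-sym u v) e = ≤-refl

      inner : ∀ u v → ⟦ P u ⟧ * (⟦ M v ⟧ * ⟦ g u v ⟧) ≤ ⟦ P u ⟧ * ⟦ g u v ⟧
      inner u v = *-monoʳ-≤ ⟦ P u ⟧ (≤-trans (*-monoˡ-≤ ⟦ g u v ⟧ (⟦⟧≤1 (M v))) (≤-reflexive (*-identityˡ ⟦ g u v ⟧)))

      toM≤out : ∀ u → toM u ≤ out u
      toM≤out u = Σ-mono (allFin n) (inner u)

    absorbed⇒≤ : ∑ (⟦_⟧ ∘ M) ≤ ∑ (⟦_⟧ ∘ P)
    absorbed⇒≤ = *-cancelʳ-≤ _ _ 2 (≤-trans ∑toM (≤-trans (Σ-mono (allFin n) toM≤out) (≤-reflexive ∑out)))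

    -- An edge that leaves `P` without entering `M` uses up one of the 2|P| edge ends at `P`. So
    -- equality forces `P` to send all its edges to `M`.
    escaping⇒< : ∀ {u v} → P u ≡ true → g u v ≡ true → M v ≡ false → ∑ (⟦_⟧ ∘ M) < ∑ (⟦_⟧ ∘ P)
    escaping⇒< {u} {v} pu e mv = *-cancelʳ-< 2 _ _ (≤-<-trans ∑toM (<-≤-trans
      (Σ-mono-< toM≤out (∈-allFin u) (Σ-mono-< (inner u) (∈-allFin v) strict)) (≤-reflexive ∑out)))
      where
      strict : ⟦ P u ⟧ * (⟦ M v ⟧ * ⟦ g u v ⟧) < ⟦ P u ⟧ * ⟦ g u v ⟧
      strict rewrite pu | e | mv = s≤s z≤n

<ᵇ-true⁺ : ∀ {a b} → a < b → (a <ᵇ b) ≡ true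
<ᵇ-true⁺ lt = Equivalence.to T-≡ (<⇒<ᵇ lt)

<ᵇ-true⁻ : ∀ {a b} → (a <ᵇ b) ≡ true → a < b
<ᵇ-true⁻ {a} {b} e = <ᵇ⇒< a b (Equivalence.from T-≡ e)

<ᵇ-false⁺ : ∀ {a b} → b ≤ a → (a <ᵇ b) ≡ false
<ᵇ-false⁺ {a} {b} le with a <ᵇ b in e
... | false = refl
... | true = contradiction (<ᵇ-true⁻ {a} {b} e) (≤⇒≯ le)

<ᵇ-false⁻ : ∀ {a b} → (a <ᵇ b) ≡ false → b ≤ a
<ᵇ-false⁻ e = ≮⇒≥ λ lt → contradiction (trans (sym e) (<ᵇ-true⁺ lt)) λ ()

-- Vertices 0, 1, 2 carry a triangle whose edges have colours 0, 1, 2 in cyclic order. Any other edge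
-- is coloured by its smaller end u: colour u if u ≤ 2, and 3 + i if b i ≤ u < b (suc i).
module OrderedColouring (b : ℕ → ℕ) (b₀ : b 0 ≡ 3) (b-step : ∀ i → b i ≤ b (suc i)) where

  b-mono : ∀ {i j} → i ≤ j → b i ≤ b j
  b-mono {i} {j} i≤j = go (≤⇒≤′ i≤j)
    where
    go : ∀ {j} → i ≤′ j → b i ≤ b j
    go ≤′-refl = ≤-refl
    go (≤′-step p) = ≤-trans (go p) (b-step _)

  3≤b : ∀ i → 3 ≤ b i
  3≤b i = ≤-trans (≤-reflexive (sym b₀)) (b-mono {0} z≤n)

  -- Blocks are tried from the top. Vertices from `b j` on lie in none of the j blocks and share the
  -- last colour 2 + j; for j = 0 the minimum with 2 has this effect.
  level : ℕ → ℕ → ℕ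
  level zero u = u ⊓ 2
  level (suc j) u = if does (b j ≤? u) then 3 + j else level j u

  level< : ∀ j u → level j u < 3 + j
  level< zero u = s≤s (m⊓n≤n u 2)
  level< (suc j) u with does (b j ≤? u)
  ... | true = ≤-refl
  ... | false = m≤n⇒m≤1+n (level< j u)

  level-below : ∀ j {u} → u < b j → level (suc j) u ≡ level j u
  level-below j {u} u<b rewrite dec-false (b j ≤? u) (<⇒≱ u<b) = refl

  level-seed : ∀ j {u} → u ≤ 2 → level j u ≡ u
  level-seed zero u≤2 = m≤n⇒m⊓n≡m u≤2
  level-seed (suc j) u≤2 = trans (level-below j (<-≤-trans (s≤s u≤2) (3≤b j))) (level-seed j u≤2)

  level-block : ∀ {i j u} → i < j → b i ≤ u → u < b (suc i) → level j u ≡ 3 + i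
  level-block {i} {j} {u} i<j bi≤u u<b = go (≤⇒≤′ i<j)
    where
    go : ∀ {j} → suc i ≤′ j → level j u ≡ 3 + i
    go ≤′-refl rewrite dec-true (b i ≤? u) bi≤u = refl
    go (≤′-step {j} p) = trans (level-below j (<-≤-trans u<b (b-mono (≤′⇒≤ p)))) (go p)

  hue : ℕ → ℕ → ℕ → ℕ
  hue j u v = if does (u ≟ 0 ×-dec v ≟ 2) then 2 else level j u

  hue< : ∀ j u v → hue j u v < 3 + j
  hue< j u v with does (u ≟ 0 ×-dec v ≟ 2)
  ... | true = s≤s (s≤s (s≤s z≤n))
  ... | false = level< j u

  hue-level : ∀ j u v → ¬ (u ≡ 0 × v ≡ 2) → hue j u v ≡ level j u
  hue-level j u v ne rewrite dec-false (u ≟ 0 ×-dec v ≟ 2) ne = refl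

  colouring : ∀ {n} j → Edge n → Fin (3 + j)
  colouring j ((u , v) , _) = fromℕ< (hue< j (toℕ u) (toℕ v))

  module _ {n j : ℕ} (b≤n : b j ≤ n) {A : Graph n} (A-F₂ : IsTwoFactor A) where

    private
      g : Fin n → Fin n → Bool
      g u v = Vec.lookup (A u) v

      g⇒∈ : ∀ {u v} → g u v ≡ true → v ∈ A u
      g⇒∈ {u} {v} = VP.lookup⇒[]= v (A u)

      ∈⇒g : ∀ {u v} → v ∈ A u → g u v ≡ true
      ∈⇒g = VP.[]=⇒lookup

      g-flip : ∀ {u v} → g u v ≡ true → g v u ≡ true
      g-flip {u} {v} e = ∈⇒g (proj₁ (proj₁ A-F₂) u v (g⇒∈ e))

      g-sym : Symm g
      g-sym u v with g u v in e | g v u in e′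
      ... | true | true = refl
      ... | false | false = refl
      ... | true | false = trans (sym (g-flip e)) e′
      ... | false | true = trans (sym e) (g-flip e′)

      g-two : ∀ u → ∑ (⟦_⟧ ∘ g u) ≡ 2
      g-two u = trans (sym (∣∣≡∑ (A u))) (proj₂ A-F₂ u)

      Avoids : ℕ → Set
      Avoids c = ∀ {u v} → toℕ u < toℕ v → g u v ≡ true → hue j (toℕ u) (toℕ v) ≢ c

      seed≤n : 3 ≤ n
      seed≤n = ≤-trans (3≤b j) b≤n

      seedVertex : ∀ {c} → c < 3 → Fin n
      seedVertex c<3 = fromℕ< (<-≤-trans c<3 seed≤n)

      toℕ-seedVertex : ∀ {c} (c<3 : c < 3) → toℕ (seedVertex c<3) ≡ c
      toℕ-seedVertex c<3 = FP.toℕ-fromℕ< _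

      -- All edges at the vertex `c` have colour `c`, except possibly the one to `y`. A 2-factor has
      -- two edges at `c`, hence one of colour `c`.
      seed-hit : ∀ {c y} → c < 3 →
                 (∀ {w} → c < w → w ≢ y → ¬ (c ≡ 0 × w ≡ 2)) →
                 (∀ {w} → w < c → w ≢ y → hue j w c ≡ c) → ¬ Avoids c
      seed-hit {c} {y} c<3 upper lower avoids = twoNeighbours g g-sym g-two x y only
        where
        x = seedVertex c<3
        x≡c = toℕ-seedVertex c<3
        only : ∀ w → g x w ≡ true → toℕ w ≡ y
        only w e with toℕ w ≟ y | <-cmp (toℕ w) c
        ... | yes w≡y | _ = w≡y
        ... | no w≢y | tri< w<c _ _ =
          contradiction (trans (cong (hue j (toℕ w)) x≡c) (lower w<c w≢y))
            (avoids (subst (toℕ w <_) (sym x≡c) w<c) (g-flip e))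
        ... | no _ | tri≈ _ w≡c _ with refl ← FP.toℕ-injective {i = w} {x} (trans w≡c (sym x≡c)) =
          contradiction (g⇒∈ e) (proj₂ (proj₁ A-F₂) w)
        ... | no w≢y | tri> _ _ c<w =
          contradiction (trans (cong (λ z → hue j z (toℕ w)) x≡c)
              (trans (hue-level j _ (toℕ w) (upper c<w w≢y)) (level-seed j (s≤s⁻¹ c<3))))
            (avoids (subst (_< toℕ w) (sym x≡c) c<w) e)

      -- `above i` is just the block of colour 3 + i and stops at `b (suc i)`. These are the sets P
      -- and M of the counting argument.
      below above : ℕ → Fin n → Bool
      below i u = toℕ u <ᵇ b i
      above i u = not (below i u) ∧ below (suc i) u

      above⁻ : ∀ i {u} → above i u ≡ true → b i ≤ toℕ u × toℕ u < b (suc i)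
      above⁻ i {u} e with below i u in p | below (suc i) u in q
      ... | false | true = <ᵇ-false⁻ p , <ᵇ-true⁻ {toℕ u} q

      ∑below : ∀ {i} → i ≤ j → ∑ (⟦_⟧ ∘ below i) ≡ b i
      ∑below i≤j = ∑-<ᵇ (≤-trans (b-mono i≤j) b≤n)

      ∑above : ∀ {i} → i < j → ∑ (⟦_⟧ ∘ above i) + b i ≡ b (suc i)
      ∑above {i} i<j = begin
        ∑ (⟦_⟧ ∘ above i) + b i
          ≡⟨ cong (∑ (⟦_⟧ ∘ above i) +_) (∑below (<⇒≤ i<j)) ⟨
        ∑ (⟦_⟧ ∘ above i) + ∑ (⟦_⟧ ∘ below i)
          ≡⟨ Σ-+ (⟦_⟧ ∘ above i) _ (allFin n) ⟨
        ∑ (λ u → ⟦ above i u ⟧ + ⟦ below i u ⟧)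
          ≡⟨ Σ-cong (allFin n) pointwise ⟩
        ∑ (⟦_⟧ ∘ below (suc i))
          ≡⟨ ∑below i<j ⟩
        b (suc i) ∎
        where
        open ≡-Reasoning
        pointwise : ∀ u → ⟦ above i u ⟧ + ⟦ below i u ⟧ ≡ ⟦ below (suc i) u ⟧
        pointwise u with below i u in p
        ... | false = +-identityʳ _
        ... | true rewrite <ᵇ-true⁺ (<-≤-trans (<ᵇ-true⁻ {toℕ u} p) (b-step i)) = refl

      block-colour : ∀ {i} → i < j → ∀ u v → b i ≤ u → u < b (suc i) → hue j u v ≡ 3 + i
      block-colour {i} i<j u v bi≤u u<b =
        trans (hue-level j u v λ { (refl , _) → contradiction (≤-trans (3≤b i) bi≤u) λ () }) (level-block i<j bi≤u u<b)

      -- An edge from the block to a vertex not before it has its smaller end in the block, hence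
      -- colour 3 + i.
      above→below : ∀ {i} → i < j → Avoids (3 + i) → ∀ {v u} → above i v ≡ true → g v u ≡ true → below i u ≡ true
      above→below {i} i<j avoids {v} {u} mv e with below i u in p | <-cmp (toℕ u) (toℕ v) | above⁻ i {v} mv
      ... | true | _ | _ = refl
      ... | false | tri< u<v _ _ | bi≤v , v<b =
        contradiction (block-colour i<j (toℕ u) (toℕ v) (<ᵇ-false⁻ p) (<-trans u<v v<b)) (avoids u<v (g-flip e))
      ... | false | tri≈ _ u≡v _ | _ with refl ← FP.toℕ-injective u≡v =
        contradiction (g⇒∈ e) (proj₂ (proj₁ A-F₂) u)
      ... | false | tri> _ _ v<u | bi≤v , v<b = contradiction (block-colour i<j (toℕ v) (toℕ u) bi≤v v<b) (avoids v<u e)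

    avoids⇒≤ : ∀ {i} → i < j → Avoids (3 + i) → b (suc i) ≤ b i + b i
    avoids⇒≤ {i} i<j avoids = subst (_≤ b i + b i) (∑above i<j) (+-monoˡ-≤ (b i)
      (subst (∑ (⟦_⟧ ∘ above i) ≤_) (∑below (<⇒≤ i<j))
        (absorbed⇒≤ g g-sym g-two (below i) (above i) (above→below i<j avoids))))

    tight⇒closed : ∀ {i} → i < j → Avoids (3 + i) → b (suc i) ≡ b i + b i →
                   ∀ {u v} → g u v ≡ true → below (suc i) u ≡ true → below (suc i) v ≡ true
    tight⇒closed {i} i<j avoids tight {u} {v} e u< with below i u in pu
    ... | false = <ᵇ-true⁺ (<-≤-trans (<ᵇ-true⁻ {toℕ v} (above→below i<j avoids u∈M e)) (b-step i))
      where
      u∈M : above i u ≡ true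
      u∈M rewrite pu | u< = refl
    ... | true with above i v in mv
    ...   | true = <ᵇ-true⁺ (proj₂ (above⁻ i {v} mv))
    ...   | false = contradiction
      (escaping⇒< g g-sym g-two (below i) (above i) (above→below i<j avoids) {u} {v} pu e mv)
      (<-irrefl (+-cancelʳ-≡ (b i) _ _ (trans (∑above i<j)
        (trans tight (cong (_+ b i) (sym (∑below (<⇒≤ i<j))))))))

    -- By `tight⇒closed`, membership in `below (suc i)` is constant along the cycle. Vertex 0 is a
    -- member, so there can be no vertex with number `b (suc i)`.
    cycle-spans : (3 ≤ n) → IsHamCycle A → ∀ {i} → i < j → Avoids (3 + i) → b (suc i) ≡ b i + b i → n ≤ b (suc i)
    cycle-spans (s≤s _) (_ , σ , inj , _ , steps) {i} i<j avoids tight = ≮⇒≥ λ b<n →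
      let outside = fromℕ< b<n
          k , σk = injective⇒surjective inj zero
          l , σl = injective⇒surjective inj outside
      in contradiction
        (trans (sym (<ᵇ-true⁺ {0} (≤-trans (s≤s z≤n) (3≤b (suc i)))))
          (trans (cong (below (suc i)) (sym σk)) (trans (constant k) (trans (sym (constant l))
            (trans (cong (below (suc i)) σl) (<ᵇ-false⁺ (≤-reflexive (sym (FP.toℕ-fromℕ< b<n)))))))))
        λ ()
      where
      same : ∀ {u v} → g u v ≡ true → below (suc i) u ≡ below (suc i) v
      same {u} {v} e with below (suc i) u in p | below (suc i) v in q
      ... | true | true = refl
      ... | false | false = refl
      ... | true | false = trans (sym (tight⇒closed i<j avoids tight e p)) q
      ... | false | true = trans (sym p) (tight⇒closed i<j avoids tight (g-flip e) q)
      constant : ∀ k → below (suc i) (σ k) ≡ below (suc i) (σ zero)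
      constant = <-weakInduction _ refl λ k eq →
        trans (sym (same (∈⇒g (steps (inject₁ k) (suc k) (inj₁ (cong suc (FP.toℕ-inject₁ k))))))) eq

    -- The counting arguments only refute avoidance; the search through all edges turns this into an
    -- actual edge.
    hits : (∀ {i} → i < j → ¬ Avoids (3 + i)) → ∀ c → ∃ λ e → e ∈E A × colouring j e ≡ c
    hits block-hit c = found (any-edge? λ e → proj₂ (proj₁ e) ∈? A (proj₁ (proj₁ e)) ×-dec colouring j e F.≟ c)
      where
      miss : ∀ c → c < 3 + j → ¬ Avoids c
      -- The exceptional neighbours 2, 0, 1 of the vertices 0, 1, 2 reflect the cyclic colouring of
      -- the triangle.
      miss 0 _ = seed-hit {y = 2} (s≤s z≤n) (λ _ w≢2 (_ , w≡2) → w≢2 w≡2) λ ()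
      miss 1 _ = seed-hit {y = 0} (s≤s (s≤s z≤n)) (λ { _ _ (() , _) }) λ { {zero} _ 0≢0 → contradiction refl 0≢0 ; {suc _} (s≤s ()) }
      miss 2 _ = seed-hit {y = 1} ≤-refl (λ { _ _ (() , _) })
        λ { {0} _ _ → refl ; {1} _ 1≢1 → contradiction refl 1≢1 ; {suc (suc _)} (s≤s (s≤s ())) }
      miss (suc (suc (suc i))) (s≤s (s≤s (s≤s i<j))) = block-hit i<j
      found : Dec (∃ λ e → e ∈E A × colouring j e ≡ c) → ∃ λ e → e ∈E A × colouring j e ≡ c
      found (yes hit) = hit
      found (no ¬hit) = contradiction
        (λ {u} {v} u<v e hue≡c → ¬hit (((u , v) , u<v) , g⇒∈ e ,
          FP.toℕ-injective (trans (FP.toℕ-fromℕ< (hue< j (toℕ u) (toℕ v))) hue≡c)))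
        (miss (toℕ c) (FP.toℕ<n c))

  F₂-polychromatic : ∀ {n j} → b j ≤ n → (∀ i → b i + b i < b (suc i)) → IsPolychromatic (F₂ n) (colouring j)
  F₂-polychromatic b≤n grows A A-F₂ =
    hits b≤n A-F₂ λ {i} i<j avoids → <⇒≱ (grows i) (avoids⇒≤ b≤n A-F₂ i<j avoids)

  -- `b j < n` keeps a vertex outside all blocks, so a closed set of size `b (suc i)` ≤ `b j` cannot
  -- contain the whole cycle. This spare vertex accounts for the n - 1 in the bound.
  HC-polychromatic : ∀ {n j} → b j < n → (∀ i → b (suc i) ≡ b i + b i) → IsPolychromatic (HC n) (colouring j)
  HC-polychromatic {n} {j} b<n doubles A hc =
    hits b≤n A-F₂ λ {i} i<j avoids →
      <⇒≱ (≤-<-trans (b-mono i<j) b<n) (cycle-spans b≤n A-F₂ 3≤n hc i<j avoids (doubles i))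
    where
    b≤n = <⇒≤ b<n
    3≤n = ≤-trans (3≤b j) b≤n
    A-F₂ = HC⊆F₂ 3≤n hc

-- Block sizes and the resulting bounds

2^⌊log₂⌋≤ : ∀ n → 1 ≤ n → 2 ^ ⌊log₂ n ⌋ ≤ n
2^⌊log₂⌋≤ n = go n (<-wellFounded n)
  where
  open ≤-Reasoning
  go : ∀ n → Acc _<_ n → 1 ≤ n → 2 ^ ⌊log₂ n ⌋ ≤ n
  go 1 _ _ = ≤-refl
  go n@(suc (suc m)) (acc rec) _ = begin
    2 ^ ⌊log₂ n ⌋             ≡⟨ cong (2 ^_) (m+[n∸m]≡n (⌊log₂⌋-mono-≤ {2} {n} (s≤s (s≤s z≤n)))) ⟨
    2 * 2 ^ (⌊log₂ n ⌋ ∸ 1)   ≡⟨ cong (λ z → 2 * 2 ^ z) (⌊log₂⌊n/2⌋⌋≡⌊log₂n⌋∸1 n) ⟨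
    2 * 2 ^ ⌊log₂ ⌊ n /2⌋ ⌋   ≤⟨ *-monoʳ-≤ 2 (go ⌊ n /2⌋ (rec (⌊n/2⌋<n (suc m))) (s≤s z≤n)) ⟩
    2 * ⌊ n /2⌋               ≡⟨ cong (⌊ n /2⌋ +_) (+-identityʳ ⌊ n /2⌋) ⟩
    ⌊ n /2⌋ + ⌊ n /2⌋         ≤⟨ +-monoʳ-≤ ⌊ n /2⌋ (⌊n/2⌋≤⌈n/2⌉ n) ⟩
    ⌊ n /2⌋ + ⌈ n /2⌉         ≡⟨ ⌊n/2⌋+⌈n/2⌉≡n n ⟩
    n                         ∎

-- Blocks of size |P| + 1 after three vertices give `b j` = 4 · 2^j - 1. With k = 3 + j, the
-- condition `b j ≤ n` reads 2^k ≤ 2(n + 1).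
F₂-colouring : ∀ {n} → 3 ≤ n → ∃ λ (f : Edge n → Fin ⌊log₂ (2 * (n + 1)) ⌋) → IsPolychromatic (F₂ n) f
F₂-colouring {n} 3≤n = subst (λ k → ∃ λ (f : Edge n → Fin k) → IsPolychromatic (F₂ n) f) (m+[n∸m]≡n 3≤k)
  (colouring j , F₂-polychromatic b≤n (λ i → ≤-reflexive (cong suc (cong (b i +_) (sym (+-identityʳ (b i)))))))
  where
  open ≤-Reasoning
  k = ⌊log₂ (2 * (n + 1)) ⌋
  j = k ∸ 3
  3≤k : 3 ≤ k
  3≤k = ⌊log₂⌋-mono-≤ {8} (*-monoʳ-≤ 2 (+-monoˡ-≤ 1 3≤n))
  b : ℕ → ℕ
  b zero = 3
  b (suc i) = suc (2 * b i)
  open OrderedColouring b refl (λ i → m≤n⇒m≤1+n (m≤n*m (b i) 2))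
  suc-b : ∀ i → suc (b i) ≡ 4 * 2 ^ i
  suc-b zero = refl
  suc-b (suc i) = trans (suc[suc[2*m]] (b i)) (trans (cong (2 *_) (suc-b i)) (swapFactors (2 ^ i)))
    where
    suc[suc[2*m]] : ∀ m → suc (suc (2 * m)) ≡ 2 * suc m
    suc[suc[2*m]] = solve-∀
    swapFactors : ∀ m → 2 * (4 * m) ≡ 4 * (2 * m)
    swapFactors = solve-∀
  b≤n : b j ≤ n
  b≤n = s≤s⁻¹ (*-cancelˡ-≤ 2 (begin
    2 * suc (b j)   ≡⟨ cong (2 *_) (suc-b j) ⟩
    2 * (4 * 2 ^ j) ≡⟨ trans (sym (*-assoc 2 4 (2 ^ j))) (sym (^-distribˡ-+-* 2 3 j)) ⟩
    2 ^ (3 + j)     ≡⟨ cong (2 ^_) (m+[n∸m]≡n 3≤k) ⟩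
    2 ^ k           ≤⟨ 2^⌊log₂⌋≤ (2 * (n + 1)) (≤-trans (s≤s z≤n) (*-monoʳ-≤ 2 (m≤n+m 1 n))) ⟩
    2 * (n + 1)     ≡⟨ cong (2 *_) (+-comm n 1) ⟩
    2 * suc n       ∎))

-- Here `b j` = 3 · 2^j may be at most n - 1; with k = 3 + j this reads 2^k ≤ 8(n - 1)/3. The three
-- colours of the triangle account for 3 ≤ k.
HC-colouring : ∀ {n} → 3 ≤ n → 3 ≤ ⌊log₂ ((8 * (n ∸ 1)) / 3) ⌋ →
  ∃ λ (f : Edge n → Fin ⌊log₂ ((8 * (n ∸ 1)) / 3) ⌋) → IsPolychromatic (HC n) f
HC-colouring {suc n} 3≤n 3≤k = subst (λ k → ∃ λ (f : Edge (suc n) → Fin k) → IsPolychromatic (HC (suc n)) f) (m+[n∸m]≡n 3≤k)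
  (colouring j , HC-polychromatic (s≤s b≤n) doubles)
  where
  open ≤-Reasoning
  x = (8 * n) / 3
  k = ⌊log₂ x ⌋
  j = k ∸ 3
  b : ℕ → ℕ
  b i = 3 * 2 ^ i
  doubles : ∀ i → b (suc i) ≡ b i + b i
  doubles i = double (2 ^ i)
    where
    double : ∀ m → 3 * (2 * m) ≡ 3 * m + 3 * m
    double = solve-∀
  open OrderedColouring b refl (λ i → ≤-trans (m≤m+n (b i) (b i)) (≤-reflexive (sym (doubles i))))
  1≤x : 1 ≤ x
  1≤x = n≢0⇒n>0 λ x≡0 → contradiction (subst (λ x → 3 ≤ ⌊log₂ x ⌋) x≡0 3≤k) λ ()
  b≤n : b j ≤ n
  b≤n = *-cancelˡ-≤ 8 (begin
    8 * (3 * 2 ^ j) ≡⟨ rearrange (2 ^ j) ⟩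
    8 * 2 ^ j * 3   ≡⟨ cong (_* 3) (sym (^-distribˡ-+-* 2 3 j)) ⟩
    2 ^ (3 + j) * 3 ≡⟨ cong (λ z → 2 ^ z * 3) (m+[n∸m]≡n 3≤k) ⟩
    2 ^ k * 3       ≤⟨ *-monoˡ-≤ 3 (2^⌊log₂⌋≤ x 1≤x) ⟩
    x * 3           ≤⟨ m/n*n≤m (8 * n) 3 ⟩
    8 * n           ∎)
    where
    rearrange : ∀ m → 8 * (3 * m) ≡ 8 * m * 3
    rearrange = solve-∀

theorem2 : ∃ λ (c : ℕ) → ∀ (n : ℕ) → 3 ≤ n →
    Σ ℕ (λ p → Σ ℕ (λ q →
    IsPolyNumber n (F₂ n) p × IsPolyNumber n (HC n) q ×
    ⌊log₂ (2 * (n + 1)) ⌋ ≤ p × p ≤ q × q ≤ ⌊log₂ n ⌋ + c ×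
    ⌊log₂ ((8 * (n ∸ 1)) / 3) ⌋ ≤ q))
theorem2 = 11 , λ n 3≤n →
  let f , f-poly = F₂-colouring 3≤n
      f-polyHC = F₂-poly⇒HC-poly 3≤n f f-poly
  in combine n 3≤n f f-poly
    (polyNumber-exists 3≤n (F₂ n) (HC⊆F₂ 3≤n) (F₂-poly? 3≤n) (f , f-poly))
    (polyNumber-exists 3≤n (HC n) id (HC-poly? 3≤n) (f , f-polyHC))
  where
  Bounded : ∀ n → Family n → ℕ → Set
  Bounded n H p = IsPolyNumber n H p × (∀ k (f : Edge n → Fin k) → IsPolychromatic H f → k ≤ p)
  combine : ∀ n (3≤n : 3 ≤ n) (f : Edge n → Fin ⌊log₂ (2 * (n + 1)) ⌋) → IsPolychromatic (F₂ n) f →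
    ∃ (Bounded n (F₂ n)) → ∃ (Bounded n (HC n)) →
    Σ ℕ (λ p → Σ ℕ (λ q →
    IsPolyNumber n (F₂ n) p × IsPolyNumber n (HC n) q ×
    ⌊log₂ (2 * (n + 1)) ⌋ ≤ p × p ≤ q × q ≤ ⌊log₂ n ⌋ + 11 ×
    ⌊log₂ ((8 * (n ∸ 1)) / 3) ⌋ ≤ q))
  combine n 3≤n f f-poly (p , pn@((h , _ , h-poly) , _) , p-max) (q , qn@((h′ , _ , h′-poly) , _) , q-max) =
    p , q , pn , qn , l≤p , p≤q , HC-poly-bound 3≤n h′ h′-poly , HC-lower (3 ≤? k)
    where
    k = ⌊log₂ ((8 * (n ∸ 1)) / 3) ⌋
    l≤p = p-max _ f f-poly
    p≤q = q-max p h (F₂-poly⇒HC-poly 3≤n h h-poly)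
    HC-lower : Dec (3 ≤ k) → k ≤ q
    HC-lower (yes 3≤k) = let f′ , f′-poly = HC-colouring 3≤n 3≤k in q-max k f′ f′-poly
    -- This happens only for n = 3, where the bound for 2-factors already gives three colours.
    HC-lower (no 3≰k) = ≤-trans (<⇒≤ (≰⇒> 3≰k))
      (≤-trans (⌊log₂⌋-mono-≤ {8} (*-monoʳ-≤ 2 (+-monoˡ-≤ 1 3≤n))) (≤-trans l≤p p≤q))
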